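{- For every natural number $n \geq 1$, the predicate $\mathit{Sk}_n(\psi)$ is not recursive.
   Context: We work in first-order predicate calculus with identity $\doteq$, over a language with countably many variables and countably infinitely many function symbols (constants being $0$-ary function symbols) and predicate symbols of every arity. Terms are variable-free; $\models \theta$ means that $\theta$ is true in every structure. Syntactic objects are coded by natural numbers in a standard way, so predicates of formulas are predicates of natural numbers (recursive, r.e., etc.). Among the constants an infinite set of distinguished constants, called unknowns, is singled out. For a quantifier-free formula $\phi(\bar\ast)$ whose unknowns are among $\bar\ast$, a sequence $\bar a$ of terms containing no unknowns is a solution if $\models \phi(\bar a)$ (simultaneous replacement of the unknowns by the terms); $\phi$ is solvable if it has a solution. An existential formula is a closed formula $\exists \bar x\, \phi(\bar x)$ with $\phi$ quantifier-free and containing no unknowns. A Herbrand skeleton of size $n$ of it is a formula $\phi(\bar\ast_1)\vee\cdots\vee\phi(\bar\ast_n)$, where the $\bar\ast_i$ are sequences of unknowns (each of the length of $\bar x$), all unknowns in them pairwise distinct. $\mathit{Sk}_n(\psi)$ holds iff $\psi$ is an existential formula having a solvable skeleton of size $n$ (whether one skeleton of size $n$ is solvable does not depend on the choice of unknowns). -}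

module Defs where

open import Data.Nat using (ℕ; zero; suc; _+_; _<_; _≤_)
open import Data.Nat.Base using (_<ᵇ_)
open import Data.Bool using (Bool; true; false; _∧_; _∨_; not; if_then_else_)
open import Data.Fin using (Fin) renaming (zero to fzero; suc to fsuc)
open import Data.Vec using (Vec; []; _∷_; lookup)
open import Data.Product using (Σ; _×_; _,_)
open import Relation.Binary.PropositionalEquality using (_≡_)
open import Relation.Binary.Definitions using (DecidableEquality)
open import Relation.Nullary using (¬_; does)
open import Level using () renaming (suc to lsuc; zero to lzero)

-- Syntax of first-order logic with identity.
-- Variables are de Bruijn indices (ℕ).  Function symbols are pairs
-- (name f : ℕ, arity k : ℕ), so there are countably infinitely many of
-- every arity (constants = arity 0).  Unknowns are a separate infinite
-- family of distinguished constants  unk i  (i : ℕ).  Predicate symbols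
-- are pairs (name, arity).

data Term : Set where
  var : ℕ → Term
  unk : ℕ → Term
  fun : ℕ → (k : ℕ) → Vec Term k → Term

data Formula : Set where
  atom  : ℕ → (k : ℕ) → Vec Term k → Formula
  _≐_   : Term → Term → Formula
  ⊥f    : Formula
  ¬f_   : Formula → Formula
  _∧f_  : Formula → Formula → Formula
  _∨f_  : Formula → Formula → Formula
  _⇒f_  : Formula → Formula → Formula
  ∀f    : Formula → Formula   -- binds de Bruijn variable 0
  ∃f    : Formula → Formula   -- binds de Bruijn variable 0

data QF : Set where
  atom  : ℕ → (k : ℕ) → Vec Term k → QF
  _≐_   : Term → Term → QF
  ⊥q    : QF
  ¬q_   : QF → QF
  _∧q_  : QF → QF → QF
  _∨q_  : QF → QF → QF
  _⇒q_  : QF → QF → QF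

embed : QF → Formula
embed (atom p k ts) = atom p k ts
embed (s ≐ t) = s ≐ t
embed ⊥q = ⊥f
embed (¬q a) = ¬f embed a
embed (a ∧q b) = embed a ∧f embed b
embed (a ∨q b) = embed a ∨f embed b
embed (a ⇒q b) = embed a ⇒f embed b

exs : ℕ → Formula → Formula
exs zero    φ = φ
exs (suc m) φ = ∃f (exs m φ)

mutual
  noUnkT : Term → Bool
  noUnkT (var _) = true
  noUnkT (unk _) = false
  noUnkT (fun _ _ ts) = noUnkTs ts

  noUnkTs : ∀ {k} → Vec Term k → Bool
  noUnkTs [] = true
  noUnkTs (t ∷ ts) = noUnkT t ∧ noUnkTs ts

mutual
  noVarT : Term → Bool
  noVarT (var _) = false
  noVarT (unk _) = true
  noVarT (fun _ _ ts) = noVarTs ts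

  noVarTs : ∀ {k} → Vec Term k → Bool
  noVarTs [] = true
  noVarTs (t ∷ ts) = noVarT t ∧ noVarTs ts

mutual
  varsBelowT : ℕ → Term → Bool
  varsBelowT m (var i) = i <ᵇ m
  varsBelowT m (unk _) = true
  varsBelowT m (fun _ _ ts) = varsBelowTs m ts

  varsBelowTs : ∀ {k} → ℕ → Vec Term k → Bool
  varsBelowTs m [] = true
  varsBelowTs m (t ∷ ts) = varsBelowT m t ∧ varsBelowTs m ts

noUnkQ : QF → Bool
noUnkQ (atom _ _ ts) = noUnkTs ts
noUnkQ (s ≐ t) = noUnkT s ∧ noUnkT t
noUnkQ ⊥q = true
noUnkQ (¬q a) = noUnkQ a
noUnkQ (a ∧q b) = noUnkQ a ∧ noUnkQ b
noUnkQ (a ∨q b) = noUnkQ a ∧ noUnkQ b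
noUnkQ (a ⇒q b) = noUnkQ a ∧ noUnkQ b

varsBelowQ : ℕ → QF → Bool
varsBelowQ m (atom _ _ ts) = varsBelowTs m ts
varsBelowQ m (s ≐ t) = varsBelowT m s ∧ varsBelowT m t
varsBelowQ m ⊥q = true
varsBelowQ m (¬q a) = varsBelowQ m a
varsBelowQ m (a ∧q b) = varsBelowQ m a ∧ varsBelowQ m b
varsBelowQ m (a ∨q b) = varsBelowQ m a ∧ varsBelowQ m b
varsBelowQ m (a ⇒q b) = varsBelowQ m a ∧ varsBelowQ m b

mutual
  substT : (ℕ → Term) → (ℕ → Term) → Term → Term
  substT s σ (var i) = s i
  substT s σ (unk i) = σ i
  substT s σ (fun f k ts) = fun f k (substTs s σ ts)

  substTs : ∀ {k} → (ℕ → Term) → (ℕ → Term) → Vec Term k → Vec Term k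
  substTs s σ [] = []
  substTs s σ (t ∷ ts) = substT s σ t ∷ substTs s σ ts

substQ : (ℕ → Term) → (ℕ → Term) → QF → QF
substQ s σ (atom p k ts) = atom p k (substTs s σ ts)
substQ s σ (a ≐ b) = substT s σ a ≐ substT s σ b
substQ s σ ⊥q = ⊥q
substQ s σ (¬q a) = ¬q substQ s σ a
substQ s σ (a ∧q b) = substQ s σ a ∧q substQ s σ b
substQ s σ (a ∨q b) = substQ s σ a ∨q substQ s σ b
substQ s σ (a ⇒q b) = substQ s σ a ⇒q substQ s σ b

substUnk : (ℕ → Term) → QF → QF
substUnk σ = substQ var σ

-- Semantics.  A structure has a carrier with (classically always
-- present) decidable identity, interpretations of all function symbols
-- and (two-valued) interpretations of all predicate symbols.

record Structure : Set₁ where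
  field
    D    : Set
    _≟D_ : DecidableEquality D
    fn   : ℕ → (k : ℕ) → Vec D k → D
    pr   : ℕ → (k : ℕ) → Vec D k → Bool

module _ (M : Structure) (ρ : ℕ → Structure.D M) (υ : ℕ → Structure.D M) where
  open Structure M

  mutual
    evalT : Term → D
    evalT (var i) = ρ i
    evalT (unk i) = υ i
    evalT (fun f k ts) = fn f k (evalTs ts)

    evalTs : ∀ {k} → Vec Term k → Vec D k
    evalTs [] = []
    evalTs (t ∷ ts) = evalT t ∷ evalTs ts

  evalQ : QF → Bool
  evalQ (atom p k ts) = pr p k (evalTs ts)
  evalQ (a ≐ b) = does (evalT a ≟D evalT b)
  evalQ ⊥q = false
  evalQ (¬q a) = not (evalQ a)
  evalQ (a ∧q b) = evalQ a ∧ evalQ b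
  evalQ (a ∨q b) = evalQ a ∨ evalQ b
  evalQ (a ⇒q b) = not (evalQ a) ∨ evalQ b

-- ⊨ θ : true in every structure (under every assignment to variables
-- and unknowns; irrelevant for the closed, unknown-free θ used below)
⊨_ : QF → Set₁
⊨ θ = (M : Structure) (ρ υ : ℕ → Structure.D M) → evalQ M ρ υ θ ≡ true

-- φ₁ ∨ ⋯ ∨ φₙ  (for n ≥ 1; the n = 0 case is never used)
⋁ : (n : ℕ) → (Fin n → QF) → QF
⋁ zero          f = ⊥q
⋁ (suc zero)    f = f fzero
⋁ (suc (suc n)) f = f fzero ∨q ⋁ (suc n) (λ i → f (fsuc i))

inst : (m : ℕ) → (Fin m → ℕ) → QF → QF
inst m u φ = substQ s unk φ
  where
    s : ℕ → Term
    s i = go m u i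
      where
        go : (m : ℕ) → (Fin m → ℕ) → ℕ → Term
        go zero    u i       = var i
        go (suc m) u zero    = unk (u fzero)
        go (suc m) u (suc i) = go m (λ j → u (fsuc j)) i

skeleton : (n m : ℕ) → (Fin n → Fin m → ℕ) → QF → QF
skeleton n m u φ = ⋁ n (λ i → inst m (u i) φ)

Distinct : ∀ {n m} → (Fin n → Fin m → ℕ) → Set
Distinct {n} {m} u = ∀ (i i′ : Fin n) (j j′ : Fin m) → u i j ≡ u i′ j′ → (i ≡ i′ × j ≡ j′)

-- a sequence of terms without unknowns (and, terms being closed,
-- without variables) replacing the unknowns
SolutionTerms : (ℕ → Term) → Set
SolutionTerms σ = ∀ k → (noUnkT (σ k) ≡ true × noVarT (σ k) ≡ true)

Solvable : QF → Set₁
Solvable θ = Σ (ℕ → Term) λ σ → SolutionTerms σ × (⊨ substUnk σ θ)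

IsExistential : Formula → ℕ → QF → Set
IsExistential ψ m φ = ψ ≡ exs m (embed φ) × noUnkQ φ ≡ true × varsBelowQ m φ ≡ true

Sk : ℕ → Formula → Set₁
Sk n ψ = Σ ℕ λ m → Σ QF λ φ → IsExistential ψ m φ ×
           Σ (Fin n → Fin m → ℕ) λ u → Distinct u × Solvable (skeleton n m u φ)

tri : ℕ → ℕ
tri zero = zero
tri (suc n) = suc n + tri n

⟨_,_⟩ : ℕ → ℕ → ℕ
⟨ a , b ⟩ = tri (a + b) + b

mutual
  codeT : Term → ℕ
  codeT (var i) = ⟨ 0 , i ⟩
  codeT (unk i) = ⟨ 1 , i ⟩
  codeT (fun f k ts) = ⟨ 2 , ⟨ f , ⟨ k , codeTs ts ⟩ ⟩ ⟩

  codeTs : ∀ {k} → Vec Term k → ℕ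
  codeTs [] = 0
  codeTs (t ∷ ts) = suc ⟨ codeT t , codeTs ts ⟩

code : Formula → ℕ
code (atom p k ts) = ⟨ 0 , ⟨ p , ⟨ k , codeTs ts ⟩ ⟩ ⟩
code (s ≐ t) = ⟨ 1 , ⟨ codeT s , codeT t ⟩ ⟩
code ⊥f = ⟨ 2 , 0 ⟩
code (¬f a) = ⟨ 3 , code a ⟩
code (a ∧f b) = ⟨ 4 , ⟨ code a , code b ⟩ ⟩
code (a ∨f b) = ⟨ 5 , ⟨ code a , code b ⟩ ⟩
code (a ⇒f b) = ⟨ 6 , ⟨ code a , code b ⟩ ⟩
code (∀f a) = ⟨ 7 , code a ⟩
code (∃f a) = ⟨ 8 , code a ⟩

SkCode : ℕ → ℕ → Set₁
SkCode n c = Σ Formula λ ψ → code ψ ≡ c × Sk n ψ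

data PR : ℕ → Set where
  Z : ∀ {n} → PR n
  S : PR 1
  P : ∀ {n} → Fin n → PR n
  C : ∀ {m n} → PR m → Vec (PR n) m → PR n
  R : ∀ {n} → PR n → PR (suc (suc n)) → PR (suc n)
  M : ∀ {n} → PR (suc n) → PR n

mutual
  data _[_]⇓_ : ∀ {n} → PR n → Vec ℕ n → ℕ → Set where
    ⇓Z : ∀ {n} {x : Vec ℕ n} → Z [ x ]⇓ 0
    ⇓S : ∀ {a} → S [ a ∷ [] ]⇓ suc a
    ⇓P : ∀ {n} {i : Fin n} {x} → P i [ x ]⇓ lookup x i
    ⇓C : ∀ {m n} {f : PR m} {gs : Vec (PR n) m} {x ys y} →
         gs [ x ]⇓* ys → f [ ys ]⇓ y → C f gs [ x ]⇓ y
    ⇓R0 : ∀ {n} {g : PR n} {h} {x y} → g [ x ]⇓ y → R g h [ 0 ∷ x ]⇓ y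
    ⇓RS : ∀ {n} {g : PR n} {h} {k x r y} →
          R g h [ k ∷ x ]⇓ r → h [ k ∷ r ∷ x ]⇓ y → R g h [ suc k ∷ x ]⇓ y
    ⇓M : ∀ {n} {f : PR (suc n)} {x y} →
         f [ y ∷ x ]⇓ 0 →
         (∀ z → z < y → Σ ℕ λ w → f [ z ∷ x ]⇓ suc w) →
         M f [ x ]⇓ y

  data _[_]⇓*_ : ∀ {m n} → Vec (PR n) m → Vec ℕ n → Vec ℕ m → Set where
    []  : ∀ {n} {x : Vec ℕ n} → [] [ x ]⇓* []
    _∷_ : ∀ {m n} {g : PR n} {gs : Vec (PR n) m} {x y ys} →
          g [ x ]⇓ y → gs [ x ]⇓* ys → (g ∷ gs) [ x ]⇓* (y ∷ ys)

Recursive : ∀ {ℓ} → (ℕ → Set ℓ) → Set ℓ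
Recursive A = Σ (PR 1) λ e →
  ∀ c → (A c → e [ c ∷ [] ]⇓ 1) × (¬ A c → e [ c ∷ [] ]⇓ 0)

{-# OPTIONS --safe #-}
-- A decider e for Sk_n is refuted by a sentence ψ that has a solvable skeleton of size n
-- exactly when e rejects the code of ψ.  To express "p(x) = 0" for a recursive p by the
-- solvability of a skeleton, p is turned into a nondeterministic counter program, whose runs
-- are sequences of configurations (tuples of words) in which each step replaces suffixes.
-- Writing a word with its last letter innermost, a step is a single ground term: its innermost
-- constants stand for the suffix before the step under one set of ground equations, and for
-- the suffix after it under another.  A list L of steps is a computation iff
--   (shape)  equations describing a tree automaton make L equal to the empty list,
--   (old)    reading the constants as "before" turns L into (start, Y),
--   (new)    reading the constants as "after" turns L into Y,
--   (pure)   Y contains none of these constants,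
-- where Y is a further unknown; all four are implications from ground equations to an equation.
-- For n > 1 the matrix is the conjunction of n copies with disjoint constants and separate
-- unknowns: if for every i the i-th disjunct failed on the i-th copy, the product of the
-- corresponding countermodels, each with a sink for the other copies, would falsify the whole
-- skeleton.
module Submission where

open import Defs
open import Data.Bool using (true; false; not; _∧_; _∨_)
open import Data.Bool.Properties using (T-≡)
open import Data.Empty using (⊥-elim)
open import Data.Fin using (Fin; toℕ; fromℕ<; combine) renaming (zero to fzero; suc to fsuc)
open import Data.Fin.Properties using (toℕ-injective; toℕ<n; toℕ-combine; toℕ-fromℕ<; combine-injective)
open import Data.List using (List; []; _∷_; _++_; _∷ʳ_; length; map; concat; applyUpTo; upTo; replicate)
open import Data.List.Membership.Propositional using (_∈_)
open import Data.List.Membership.Propositional.Properties using (∈-++⁺ˡ; ∈-++⁺ʳ; ∈-map⁺; ∈-upTo⁺)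
open import Data.List.Properties using (++-assoc; ++-identityʳ; ∷ʳ-injective)
open import Data.List.Relation.Unary.All using (All; []; _∷_; universal)
import Data.List.Relation.Unary.All as All
open import Data.List.Relation.Unary.All.Properties
  using (++⁺; ++⁻ˡ; concat⁺; concat⁻; applyUpTo⁺₁; applyUpTo⁺₂; applyUpTo⁻; map⁺; map⁻)
open import Data.List.Relation.Unary.Any using (here; there)
open import Data.Maybe using (Maybe; just; nothing; zipWith) renaming (map to mapM)
open import Data.Maybe.Properties using (just-injective) renaming (≡-dec to Maybe-≡-dec)
open import Data.Nat
open import Data.Nat.ListAction using (sum)
open import Data.Nat.Properties
open import Data.Product using (Σ; ∃; _×_; _,_; proj₁; proj₂)
open import Data.Sum using (_⊎_; inj₁; inj₂; [_,_]′)
open import Data.Unit using (⊤; tt)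
open import Data.Vec using (Vec; []; _∷_; lookup; tabulate) renaming (map to mapᵛ; replicate to replicateᵛ)
open import Data.Vec.Properties
  using (lookup-map; lookup∘tabulate; tabulate∘lookup; tabulate-cong; lookup-replicate)
  renaming (≡-dec to Vec-≡-dec)
open import Data.Vec.Relation.Unary.All using ([]; _∷_) renaming (All to Allᵛ; map to Allᵛ-map)
open import Data.Vec.Relation.Unary.All.Properties using (lookup⁺)
open import Function using (_∘_; Equivalence)
open import Relation.Binary.Definitions using (DecidableEquality; tri<; tri≈; tri>)
open import Relation.Binary.PropositionalEquality
open import Relation.Nullary using (¬_; Dec; yes; no; does)
open import Relation.Nullary.Decidable using (map′; _×-dec_; dec-true)

-- Coding of formulas and computable functions

-- A skeleton with `n > 1` disjuncts may be valid although no disjunct is: which one holds can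
-- change from structure to structure, so the disjuncts cannot be examined one at a time. What helps
-- is that every clause has a structure of normal forms for its own hypotheses in which its
-- conclusion is decidable. One clause per disjunct, violated if any is, can therefore be fixed
-- before the product of these structures is formed; the disjunct that holds in the product
-- satisfies its fixed clause, hence all four. The shape needs a structure of its own, which
-- collapses a list of steps to its end and forgets the words; an invariant attached to the values
-- recovers them. The self-reference needs no fixed-point theorem. The input enters only through the
-- equations between `ι` and a numeral in front of the matrix, so the code of the sentence is a
-- fixed computable function of the input and the code of the remainder. The remainder contains the
-- program for `e` after this function, and its own code is then used as the input.

tri-mono-≤ : ∀ {m n} → m ≤ n → tri m ≤ tri n
tri-mono-≤ z≤n = z≤n
tri-mono-≤ (s≤s m≤n) = +-mono-≤ (s≤s m≤n) (tri-mono-≤ m≤n)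

-- All codes of pairs with sum `s` lie below `tri (suc s)`, where the codes of larger sums begin.
⟨⟩-mono-< : ∀ a b c d → a + b < c + d → ⟨ a , b ⟩ < ⟨ c , d ⟩
⟨⟩-mono-< a b c d s<s′ = begin-strict
  tri (a + b) + b        <⟨ +-monoʳ-< (tri (a + b)) (s≤s (m≤n+m b a)) ⟩
  tri (a + b) + suc (a + b) ≡⟨ +-comm (tri (a + b)) _ ⟩
  tri (suc (a + b))      ≤⟨ tri-mono-≤ s<s′ ⟩
  tri (c + d)            ≤⟨ m≤m+n _ d ⟩
  tri (c + d) + d        ∎
  where open ≤-Reasoning

⟨⟩-injective : ∀ {a b c d} → ⟨ a , b ⟩ ≡ ⟨ c , d ⟩ → a ≡ c × b ≡ d
⟨⟩-injective {a} {b} {c} {d} eq with <-cmp (a + b) (c + d)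
... | tri< lt _ _ = ⊥-elim (<⇒≢ (⟨⟩-mono-< a b c d lt) eq)
... | tri> _ _ gt = ⊥-elim (<⇒≢ (⟨⟩-mono-< c d a b gt) (sym eq))
... | tri≈ _ s≡s′ _ = +-cancelʳ-≡ b a c (trans s≡s′ (cong (c +_) (sym b≡d))) , b≡d
  where
  b≡d : b ≡ d
  b≡d = +-cancelˡ-≡ (tri (a + b)) b d (trans eq (cong (λ s → tri s + d) (sym s≡s′)))

tag≡ : ∀ {a b c d} → ⟨ a , b ⟩ ≡ ⟨ c , d ⟩ → a ≡ c
tag≡ eq = proj₁ (⟨⟩-injective eq)

arg≡ : ∀ {a b c d} → ⟨ a , b ⟩ ≡ ⟨ c , d ⟩ → b ≡ d
arg≡ {a} {b} {c} {d} eq = proj₂ (⟨⟩-injective {a} {b} {c} {d} eq)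

-- Comparing tags as numerals leaves only matching constructors to `byTag`; the other cases are
-- refuted by unequal tags.
tagT argT : Term → ℕ
tagT (var _) = 0
tagT (unk _) = 1
tagT (fun _ _ _) = 2
argT (var i) = i
argT (unk i) = i
argT (fun f k ts) = ⟨ f , ⟨ k , codeTs ts ⟩ ⟩

codeT≡ : ∀ t → codeT t ≡ ⟨ tagT t , argT t ⟩
codeT≡ (var _) = refl
codeT≡ (unk _) = refl
codeT≡ (fun _ _ _) = refl

mutual
  codeT-injective : ∀ s t → codeT s ≡ codeT t → s ≡ t
  codeT-injective s t eq = byTag s t (tag≡ eq′) (arg≡ {tagT s} {_} {tagT t} eq′)
    where eq′ = trans (sym (codeT≡ s)) (trans eq (codeT≡ t))

  byTag : ∀ s t → tagT s ≡ tagT t → argT s ≡ argT t → s ≡ t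
  byTag (var i) (var j) _ eq = cong var eq
  byTag (unk i) (unk j) _ eq = cong unk eq
  byTag (fun f k ts) (fun g l us) _ eq
    with refl ← tag≡ {f} {_} {g} eq | eq′ ← arg≡ {f} {_} {g} eq
    with refl ← tag≡ {k} {_} {l} eq′ | eq″ ← arg≡ {k} {_} {l} eq′
    = cong (fun f k) (codeTs-injective ts us eq″)

  codeTs-injective : ∀ {k} (ts us : Vec Term k) → codeTs ts ≡ codeTs us → ts ≡ us
  codeTs-injective [] [] _ = refl
  codeTs-injective (t ∷ ts) (u ∷ us) eq =
    cong₂ _∷_ (codeT-injective t u (tag≡ eq′)) (codeTs-injective ts us (arg≡ {codeT t} {_} {codeT u} eq′))
    where eq′ = suc-injective eq

tagF argF : Formula → ℕ
tagF (atom _ _ _) = 0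
tagF (_ ≐ _) = 1
tagF ⊥f = 2
tagF (¬f _) = 3
tagF (_ ∧f _) = 4
tagF (_ ∨f _) = 5
tagF (_ ⇒f _) = 6
tagF (∀f _) = 7
tagF (∃f _) = 8
argF (atom p k ts) = ⟨ p , ⟨ k , codeTs ts ⟩ ⟩
argF (s ≐ t) = ⟨ codeT s , codeT t ⟩
argF ⊥f = 0
argF (¬f a) = code a
argF (a ∧f b) = ⟨ code a , code b ⟩
argF (a ∨f b) = ⟨ code a , code b ⟩
argF (a ⇒f b) = ⟨ code a , code b ⟩
argF (∀f a) = code a
argF (∃f a) = code a

code≡ : ∀ ψ → code ψ ≡ ⟨ tagF ψ , argF ψ ⟩
code≡ (atom _ _ _) = refl
code≡ (_ ≐ _) = refl
code≡ ⊥f = refl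
code≡ (¬f _) = refl
code≡ (_ ∧f _) = refl
code≡ (_ ∨f _) = refl
code≡ (_ ⇒f _) = refl
code≡ (∀f _) = refl
code≡ (∃f _) = refl

mutual
  code-injective : ∀ ψ χ → code ψ ≡ code χ → ψ ≡ χ
  code-injective ψ χ eq = byTagF ψ χ (tag≡ eq′) (arg≡ {tagF ψ} {_} {tagF χ} eq′)
    where eq′ = trans (sym (code≡ ψ)) (trans eq (code≡ χ))

  byTagF : ∀ ψ χ → tagF ψ ≡ tagF χ → argF ψ ≡ argF χ → ψ ≡ χ
  byTagF (atom p k ts) (atom q l us) _ eq
    with refl ← tag≡ {p} {_} {q} eq | eq′ ← arg≡ {p} {_} {q} eq
    with refl ← tag≡ {k} {_} {l} eq′ | eq″ ← arg≡ {k} {_} {l} eq′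
    = cong (atom p k) (codeTs-injective ts us eq″)
  byTagF (s ≐ t) (u ≐ v) _ eq =
    cong₂ _≐_ (codeT-injective s u (tag≡ eq)) (codeT-injective t v (arg≡ {codeT s} {_} {codeT u} eq))
  byTagF ⊥f ⊥f _ _ = refl
  byTagF (¬f a) (¬f b) _ eq = cong ¬f_ (code-injective a b eq)
  byTagF (a ∧f b) (c ∧f d) _ eq =
    cong₂ _∧f_ (code-injective a c (tag≡ eq)) (code-injective b d (arg≡ {code a} {_} {code c} eq))
  byTagF (a ∨f b) (c ∨f d) _ eq =
    cong₂ _∨f_ (code-injective a c (tag≡ eq)) (code-injective b d (arg≡ {code a} {_} {code c} eq))
  byTagF (a ⇒f b) (c ⇒f d) _ eq =
    cong₂ _⇒f_ (code-injective a c (tag≡ eq)) (code-injective b d (arg≡ {code a} {_} {code c} eq))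
  byTagF (∀f a) (∀f b) _ eq = cong ∀f (code-injective a b eq)
  byTagF (∃f a) (∃f b) _ eq = cong ∃f (code-injective a b eq)

-- Recovers the matrix of an existential formula without comparing numbers of quantifiers; in `Sk`
-- both the number and the matrix come from the witness.
matrix : Formula → QF
matrix (atom p k ts) = atom p k ts
matrix (s ≐ t) = s ≐ t
matrix ⊥f = ⊥q
matrix (¬f a) = ¬q matrix a
matrix (a ∧f b) = matrix a ∧q matrix b
matrix (a ∨f b) = matrix a ∨q matrix b
matrix (a ⇒f b) = matrix a ⇒q matrix b
matrix (∀f a) = matrix a
matrix (∃f a) = matrix a

matrix-embed : ∀ φ → matrix (embed φ) ≡ φ
matrix-embed (atom p k ts) = refl
matrix-embed (s ≐ t) = refl
matrix-embed ⊥q = refl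
matrix-embed (¬q a) = cong ¬q_ (matrix-embed a)
matrix-embed (a ∧q b) = cong₂ _∧q_ (matrix-embed a) (matrix-embed b)
matrix-embed (a ∨q b) = cong₂ _∨q_ (matrix-embed a) (matrix-embed b)
matrix-embed (a ⇒q b) = cong₂ _⇒q_ (matrix-embed a) (matrix-embed b)

matrix-exs : ∀ m φ → matrix (exs m (embed φ)) ≡ φ
matrix-exs zero φ = matrix-embed φ
matrix-exs (suc m) φ = matrix-exs m φ

-- Determinism of evaluation and a stock of computable functions

mutual
  ⇓-deterministic : ∀ {n} {f : PR n} {x y z} → f [ x ]⇓ y → f [ x ]⇓ z → y ≡ z
  ⇓-deterministic ⇓Z ⇓Z = refl
  ⇓-deterministic ⇓S ⇓S = refl
  ⇓-deterministic ⇓P ⇓P = refl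
  ⇓-deterministic (⇓C gs f) (⇓C gs′ f′) with refl ← ⇓*-deterministic gs gs′ = ⇓-deterministic f f′
  ⇓-deterministic (⇓R0 g) (⇓R0 g′) = ⇓-deterministic g g′
  ⇓-deterministic (⇓RS r h) (⇓RS r′ h′) with refl ← ⇓-deterministic r r′ = ⇓-deterministic h h′
  ⇓-deterministic (⇓M {y = y} f b) (⇓M {y = z} f′ b′) with <-cmp y z
  ... | tri≈ _ y≡z _ = y≡z
  ... | tri< y<z _ _ = ⊥-elim (0≢1+n (⇓-deterministic f (proj₂ (b′ y y<z))))
  ... | tri> _ _ z<y = ⊥-elim (1+n≢0 (⇓-deterministic (proj₂ (b z z<y)) f′))

  ⇓*-deterministic : ∀ {m n} {gs : Vec (PR n) m} {x ys zs} → gs [ x ]⇓* ys → gs [ x ]⇓* zs → ys ≡ zs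
  ⇓*-deterministic [] [] = refl
  ⇓*-deterministic (g ∷ gs) (g′ ∷ gs′) = cong₂ _∷_ (⇓-deterministic g g′) (⇓*-deterministic gs gs′)

Computable : (ℕ → ℕ) → Set
Computable F = Σ (PR 1) λ f → ∀ x → f [ x ∷ [] ]⇓ F x

id-computable : Computable (λ x → x)
id-computable = P fzero , λ _ → ⇓P

suc-computable : ∀ {F} → Computable F → Computable (λ x → suc (F x))
suc-computable (f , f⇓) = C S (f ∷ []) , λ x → ⇓C (f⇓ x ∷ []) ⇓S

const-computable : ∀ c → Computable (λ _ → c)
const-computable zero = Z , λ _ → ⇓Z
const-computable (suc c) = suc-computable (const-computable c)

iterate-computable : ∀ {F : ℕ → ℕ} {G} c → Computable G →
                     F 0 ≡ c → (∀ x → F (suc x) ≡ G (F x)) → Computable F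
iterate-computable {F} {G} c (g , g⇓) F0 Fs = R (proj₁ c₀) step , run
  where
  constant : ∀ c → Σ (PR 0) λ f → f [ [] ]⇓ c
  constant zero = Z , ⇓Z
  constant (suc c) = C S (proj₁ (constant c) ∷ []) , ⇓C (proj₂ (constant c) ∷ []) ⇓S
  c₀ = constant c
  step : PR 2
  step = C g (P (fsuc fzero) ∷ [])
  run : ∀ x → R (proj₁ c₀) step [ x ∷ [] ]⇓ F x
  run zero = subst (R (proj₁ c₀) step [ 0 ∷ [] ]⇓_) (sym F0) (⇓R0 (proj₂ c₀))
  run (suc x) = subst (R (proj₁ c₀) step [ suc x ∷ [] ]⇓_) (sym (Fs x)) (⇓RS (run x) (⇓C (⇓P ∷ []) (g⇓ (F x))))

+-PR : PR 2
+-PR = R (P fzero) (C S (P (fsuc fzero) ∷ []))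

+-PR⇓ : ∀ a b → +-PR [ a ∷ b ∷ [] ]⇓ (a + b)
+-PR⇓ zero b = ⇓R0 ⇓P
+-PR⇓ (suc a) b = ⇓RS (+-PR⇓ a b) (⇓C (⇓P ∷ []) ⇓S)

+-computable : ∀ {F G} → Computable F → Computable G → Computable (λ x → F x + G x)
+-computable (f , f⇓) (g , g⇓) = C +-PR (f ∷ g ∷ []) , λ x → ⇓C (f⇓ x ∷ g⇓ x ∷ []) (+-PR⇓ _ _)

∘-computable : ∀ {F G} → Computable F → Computable G → Computable (λ x → F (G x))
∘-computable (f , f⇓) (g , g⇓) = C f (g ∷ []) , λ x → ⇓C (g⇓ x ∷ []) (f⇓ _)

tri-computable : Computable tri
tri-computable = R Z (C +-PR (C S (P fzero ∷ []) ∷ P (fsuc fzero) ∷ [])) , run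
  where
  run : ∀ x → _ [ x ∷ [] ]⇓ tri x
  run zero = ⇓R0 ⇓Z
  run (suc x) = ⇓RS (run x) (⇓C (⇓C (⇓P ∷ []) ⇓S ∷ ⇓P ∷ []) (+-PR⇓ _ _))

⟨⟩-computable : ∀ {F G} → Computable F → Computable G → Computable (λ x → ⟨ F x , G x ⟩)
⟨⟩-computable F G = +-computable (∘-computable tri-computable (+-computable F G)) G

-- Nondeterministic counter programs for the graphs of recursive functions

data Op : Set where
  inc dec tz : Op

data Cmd : Set where
  op   : Op → ℕ → Cmd
  _⨾_  : Cmd → Cmd → Cmd
  star : Cmd → Cmd

infixr 5 _⨾_

State : Set
State = ℕ → ℕ

OpRel : Op → ℕ → ℕ → Set
OpRel inc a b = b ≡ suc a
OpRel dec a b = a ≡ suc b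
OpRel tz  a b = a ≡ 0 × b ≡ 0

Off : ℕ → State → State → Set
Off r s s′ = ∀ x → x ≢ r → s′ x ≡ s x

-- States are functions compared pointwise, so `done` accepts any pointwise equal state as the final
-- one.
data Star (_⟶_ : State → State → Set) (s s′ : State) : Set where
  done : (∀ x → s′ x ≡ s x) → Star _⟶_ s s′
  step : ∀ {t} → s ⟶ t → Star _⟶_ t s′ → Star _⟶_ s s′

⟦_⟧ : Cmd → State → State → Set
⟦ op o r ⟧ s s′ = OpRel o (s r) (s′ r) × Off r s s′
⟦ c ⨾ d ⟧  s s′ = ∃ λ t → ⟦ c ⟧ s t × ⟦ d ⟧ t s′
⟦ star c ⟧ = Star ⟦ c ⟧

Star-snoc : ∀ {_⟶_ s t u} → (∀ {s s′ t} → (∀ x → s′ x ≡ s x) → s′ ⟶ t → s ⟶ t) →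
            Star _⟶_ s t → t ⟶ u → Star _⟶_ s u
Star-snoc resp (done eq) r = step (resp eq r) (done λ _ → refl)
Star-snoc resp (step q qs) r = step q (Star-snoc resp qs r)

⟦⟧-respˡ : ∀ c {s s′ t} → (∀ x → s′ x ≡ s x) → ⟦ c ⟧ s′ t → ⟦ c ⟧ s t
⟦⟧-respˡ (op o r) {t = t} eq (p , off) =
  subst (λ a → OpRel o a (t r)) (eq r) p , λ x x≢r → trans (off x x≢r) (eq x)
⟦⟧-respˡ (c ⨾ d) eq (u , p , q) = u , ⟦⟧-respˡ c eq p , q
⟦⟧-respˡ (star c) eq (done eq′) = done λ x → trans (eq′ x) (eq x)
⟦⟧-respˡ (star c) eq (step p q) = step (⟦⟧-respˡ c eq p) q

-- Register macros: guessing, clearing, comparing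

set : State → ℕ → ℕ → State
set s r v x with x ≟ r
... | yes _ = v
... | no  _ = s x

set-at : ∀ s r v → set s r v r ≡ v
set-at s r v with r ≟ r
... | yes _ = refl
... | no r≢r = ⊥-elim (r≢r refl)

set-off : ∀ s r v → Off r s (set s r v)
set-off s r v x x≢r with x ≟ r
... | yes x≡r = ⊥-elim (x≢r x≡r)
... | no _ = refl

Off-≗ : ∀ {r s s′} → s′ r ≡ s r → Off r s s′ → ∀ x → s′ x ≡ s x
Off-≗ {r} eq off x with x ≟ r
... | yes refl = eq
... | no x≢r = off x x≢r

Off-trans : ∀ {r s t u} → Off r s t → Off r t u → Off r s u
Off-trans p q x x≢r = trans (q x x≢r) (p x x≢r)

Off-sym : ∀ {r s t} → Off r s t → Off r t s
Off-sym p x x≢r = sym (p x x≢r)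

-- `havoc` can leave any value in `r`. This is how intermediate results arise: they are guessed and
-- afterwards verified.
havoc clear : ℕ → Cmd
havoc r = star (op dec r) ⨾ star (op inc r)
clear r = star (op dec r) ⨾ op tz r

star-op-sound : ∀ o {r s s′} → ⟦ star (op o r) ⟧ s s′ → Off r s s′
star-op-sound _ (done eq) x _ = eq x
star-op-sound o (step (_ , p) q) = Off-trans p (star-op-sound o q)

star-dec-complete : ∀ n {r s s′} → s r ≡ n + s′ r → Off r s s′ → ⟦ star (op dec r) ⟧ s s′
star-dec-complete zero eq off = done (Off-≗ (sym eq) off)
star-dec-complete (suc n) {r} {s} {s′} eq off =
  step (trans eq (cong suc (sym at)) , set-off s r _)
       (star-dec-complete n at (Off-trans (Off-sym (set-off s r _)) off))
  where at = set-at s r (n + s′ r)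

star-inc-complete : ∀ n {r s s′} → s′ r ≡ n + s r → Off r s s′ → ⟦ star (op inc r) ⟧ s s′
star-inc-complete zero eq off = done (Off-≗ eq off)
star-inc-complete (suc n) {r} {s} eq off =
  step (at , set-off s r _)
       (star-inc-complete n (trans eq (trans (sym (+-suc n (s r))) (cong (n +_) (sym at))))
         (Off-trans (Off-sym (set-off s r _)) off))
  where at = set-at s r (suc (s r))

havoc-sound : ∀ {r s s′} → ⟦ havoc r ⟧ s s′ → Off r s s′
havoc-sound (_ , p , q) = Off-trans (star-op-sound dec p) (star-op-sound inc q)

havoc-complete : ∀ {r s s′} → Off r s s′ → ⟦ havoc r ⟧ s s′
havoc-complete {r} {s} {s′} off =
  set s r 0 ,
  star-dec-complete (s r) (sym (trans (cong (s r +_) at) (+-identityʳ (s r)))) (set-off s r 0) ,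
  star-inc-complete (s′ r) (sym (trans (cong (s′ r +_) at) (+-identityʳ (s′ r))))
    (Off-trans (Off-sym (set-off s r 0)) off)
  where at = set-at s r 0

clear-sound : ∀ {r s s′} → ⟦ clear r ⟧ s s′ → s′ r ≡ 0 × Off r s s′
clear-sound (_ , p , (_ , eq) , q) = eq , Off-trans (star-op-sound dec p) q

clear-complete : ∀ {r s s′} → s′ r ≡ 0 → Off r s s′ → ⟦ clear r ⟧ s s′
clear-complete {r} {s} {s′} eq off =
  s′ , star-dec-complete (s r) (sym (trans (cong (s r +_) eq) (+-identityʳ (s r)))) off ,
  (eq , eq) , λ _ _ → refl

tz-sound : ∀ {r s s′} → ⟦ op tz r ⟧ s s′ → s r ≡ 0 × (∀ x → s′ x ≡ s x)
tz-sound ((eq , eq′) , off) = eq , Off-≗ (trans eq′ (sym eq)) off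

tz-complete : ∀ {r s} → s r ≡ 0 → ⟦ op tz r ⟧ s s
tz-complete eq = (eq , eq) , λ _ _ → refl

-- Non-destructive comparison: v and r are moved together to the temporary t and back.
eqTest : (t v r : ℕ) → Cmd
eqTest t v r =
  clear t ⨾ star (op dec v ⨾ op dec r ⨾ op inc t) ⨾ op tz v ⨾ op tz r ⨾
  star (op inc v ⨾ op inc r ⨾ op dec t) ⨾ op tz t

module Three {v r t : ℕ} (v≢r : v ≢ r) (v≢t : v ≢ t) (r≢t : r ≢ t) where

  Off₃ : State → State → Set
  Off₃ s s′ = ∀ x → x ≢ v → x ≢ r → x ≢ t → s′ x ≡ s x

  set₃ : State → ℕ → ℕ → ℕ → State
  set₃ s a b c = set (set (set s v a) r b) t c

  module _ (s : State) (a b c : ℕ) where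
    set₃-v : set₃ s a b c v ≡ a
    set₃-v = trans (set-off _ t c v v≢t) (trans (set-off _ r b v v≢r) (set-at s v a))
    set₃-r : set₃ s a b c r ≡ b
    set₃-r = trans (set-off _ t c r r≢t) (set-at _ r b)
    set₃-t : set₃ s a b c t ≡ c
    set₃-t = set-at _ t c
    set₃-off : Off₃ s (set₃ s a b c)
    set₃-off x x≢v x≢r x≢t =
      trans (set-off _ t c x x≢t) (trans (set-off _ r b x x≢r) (set-off s v a x x≢v))

  ops-sound : ∀ {o₁ o₂ o₃ s s′} → ⟦ op o₁ v ⨾ op o₂ r ⨾ op o₃ t ⟧ s s′ →
    OpRel o₁ (s v) (s′ v) × OpRel o₂ (s r) (s′ r) × OpRel o₃ (s t) (s′ t) × Off₃ s s′
  ops-sound {o₁} {o₂} {o₃} {s} {s′} (s₁ , (p , off₁) , s₂ , (q , off₂) , (u , off₃)) =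
    subst (OpRel o₁ (s v)) (sym (trans (off₃ v v≢t) (off₂ v v≢r))) p ,
    subst₂ (OpRel o₂) (off₁ r (≢-sym v≢r)) (sym (off₃ r r≢t)) q ,
    subst (λ a → OpRel o₃ a (s′ t)) (trans (off₂ t (≢-sym r≢t)) (off₁ t (≢-sym v≢t))) u ,
    λ x x≢v x≢r x≢t → trans (off₃ x x≢t) (trans (off₂ x x≢r) (off₁ x x≢v))

  ops-complete : ∀ {o₁ o₂ o₃ s s′} →
    OpRel o₁ (s v) (s′ v) → OpRel o₂ (s r) (s′ r) → OpRel o₃ (s t) (s′ t) → Off₃ s s′ →
    ⟦ op o₁ v ⨾ op o₂ r ⨾ op o₃ t ⟧ s s′
  ops-complete {o₁} {o₂} {o₃} {s} {s′} p q u off =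
    s₁ , (subst (OpRel o₁ (s v)) (sym (set-at s v _)) p , set-off s v _) ,
    s₂ , (subst₂ (OpRel o₂) (sym (set-off s v _ r (≢-sym v≢r))) (sym (set-at s₁ r _)) q , set-off s₁ r _) ,
    (subst (λ a → OpRel o₃ a (s′ t))
      (sym (trans (set-off s₁ r _ t (≢-sym r≢t)) (set-off s v _ t (≢-sym v≢t)))) u , off′)
    where
    s₁ = set s v (s′ v)
    s₂ = set s₁ r (s′ r)
    off′ : Off t s₂ s′
    off′ x x≢t with x ≟ r
    ... | yes refl = refl
    ... | no x≢r with x ≟ v
    ... | yes refl = refl
    ... | no x≢v = off x x≢v x≢r x≢t

  -- The net effect of `n` rounds of `out`. As a round of `back` undoes one of `out`, the same
  -- relation with the states exchanged describes `back`.
  Move : ℕ → State → State → Set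
  Move n s s′ = s v ≡ n + s′ v × s r ≡ n + s′ r × s′ t ≡ n + s t × Off₃ s s′

  Move-≗ : ∀ {s s′} → (∀ x → s′ x ≡ s x) → Move 0 s s′
  Move-≗ eq = sym (eq v) , sym (eq r) , eq t , λ x _ _ _ → eq x

  Move-0 : ∀ {s s′} → Move 0 s s′ → ∀ x → s′ x ≡ s x
  Move-0 (p , q , u , off) x with x ≟ v
  ... | yes refl = sym p
  ... | no x≢v with x ≟ r
  ... | yes refl = sym q
  ... | no x≢r with x ≟ t
  ... | yes refl = u
  ... | no x≢t = off x x≢v x≢r x≢t

  Move-trans : ∀ {m n s s₁ s′} → Move m s s₁ → Move n s₁ s′ → Move (m + n) s s′
  Move-trans {m} {n} {s} {s₁} {s′} (p , q , u , off) (p′ , q′ , u′ , off′) =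
    trans p (trans (cong (m +_) p′) (sym (+-assoc m n _))) ,
    trans q (trans (cong (m +_) q′) (sym (+-assoc m n _))) ,
    trans u′ (trans (cong (n +_) u) (trans (sym (+-assoc n m _)) (cong (_+ s t) (+-comm n m)))) ,
    λ x x≢v x≢r x≢t → trans (off′ x x≢v x≢r x≢t) (off x x≢v x≢r x≢t)

  split : ∀ m {n s s′} → Move (m + n) s s′ → ∃ λ s₁ → Move m s s₁ × Move n s₁ s′
  split m {n} {s} {s′} (p , q , u , off) = s₁ ,
    (trans p (trans (+-assoc m n _) (cong (m +_) (sym (set₃-v s _ _ _)))) ,
     trans q (trans (+-assoc m n _) (cong (m +_) (sym (set₃-r s _ _ _)))) ,
     set₃-t s _ _ _ , set₃-off s _ _ _) ,
    (set₃-v s _ _ _ , set₃-r s _ _ _ ,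
     trans u (trans (cong (_+ s t) (+-comm m n)) (trans (+-assoc n m _) (cong (n +_) (sym (set₃-t s _ _ _))))) ,
     λ x x≢v x≢r x≢t → trans (off x x≢v x≢r x≢t) (sym (set₃-off s _ _ _ x x≢v x≢r x≢t)))
    where s₁ = set₃ s (n + s′ v) (n + s′ r) (m + s t)

  out back : Cmd
  out  = op dec v ⨾ op dec r ⨾ op inc t
  back = op inc v ⨾ op inc r ⨾ op dec t

  out-sound : ∀ {s s′} → ⟦ star out ⟧ s s′ → ∃ λ n → Move n s s′
  out-sound (done eq) = 0 , Move-≗ eq
  out-sound (step p q) =
    let n , m = out-sound q in suc n , Move-trans {1} {n} (ops-sound {dec} {dec} {inc} p) m

  back-sound : ∀ {s s′} → ⟦ star back ⟧ s s′ → ∃ λ n → Move n s′ s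
  back-sound (done eq) = 0 , Move-≗ (λ x → sym (eq x))
  back-sound (step p q) with a , b , c , off ← ops-sound {inc} {inc} {dec} p | n , m ← back-sound q =
    n + 1 , Move-trans {n} {1} m (a , b , c , λ x x≢v x≢r x≢t → sym (off x x≢v x≢r x≢t))

  out-complete : ∀ n {s s′} → Move n s s′ → ⟦ star out ⟧ s s′
  out-complete zero m = done (Move-0 m)
  out-complete (suc n) m with s₁ , (a , b , c , off) , m′ ← split 1 {n} m =
    step (ops-complete {dec} {dec} {inc} a b c off) (out-complete n m′)

  back-complete : ∀ n {s s′} → Move n s′ s → ⟦ star back ⟧ s s′
  back-complete zero m = done (λ x → sym (Move-0 m x))
  back-complete (suc n) {s} {s′} m
    with s₁ , m′ , (a , b , c , off) ← split n {1} (subst (λ k → Move k s′ s) (sym (+-comm n 1)) m) =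
    step (ops-complete {inc} {inc} {dec} a b c (λ x x≢v x≢r x≢t → sym (off x x≢v x≢r x≢t)))
         (back-complete n m′)

  -- Both registers reach zero after the same number of rounds, hence were equal. The temporary
  -- register is zero before these rounds and at the end, so equally many rounds run back and
  -- restore both registers.
  eqTest-sound : ∀ {s s′} → ⟦ eqTest t v r ⟧ s s′ → s v ≡ s r × Off t s s′
  eqTest-sound {s} {s′} (s₁ , cl , s₂ , o , s₃ , zv , s₄ , zr , s₅ , b , zt)
    with t₁≡0 , off₁ ← clear-sound cl
       | n , pv , pr , pt , poff ← out-sound o
       | v₂≡0 , eq₃ ← tz-sound zv
       | r₃≡0 , eq₄ ← tz-sound zr
       | m , qv , qr , qt , qoff ← back-sound b
       | t₅≡0 , eq₆ ← tz-sound zt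
    = trans sv (sym sr) , off
    where
    r₂≡0 : s₂ r ≡ 0
    r₂≡0 = trans (sym (eq₃ r)) r₃≡0
    eq₄′ : ∀ x → s₄ x ≡ s₂ x
    eq₄′ x = trans (eq₄ x) (eq₃ x)
    sv : s v ≡ n
    sv = trans (sym (off₁ v v≢t)) (trans pv (trans (cong (n +_) v₂≡0) (+-identityʳ n)))
    sr : s r ≡ n
    sr = trans (sym (off₁ r r≢t)) (trans pr (trans (cong (n +_) r₂≡0) (+-identityʳ n)))
    m≡n : m ≡ n
    m≡n = trans (sym (trans (cong (m +_) t₅≡0) (+-identityʳ m)))
      (trans (sym qt) (trans (eq₄′ t) (trans pt (trans (cong (n +_) t₁≡0) (+-identityʳ n)))))
    off : Off t s s′
    off x x≢t with x ≟ v
    ... | yes refl = trans (eq₆ v) (trans qv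
          (trans (cong (m +_) (trans (eq₄′ v) v₂≡0)) (trans (+-identityʳ m) (trans m≡n (sym sv)))))
    ... | no x≢v with x ≟ r
    ... | yes refl = trans (eq₆ r) (trans qr
          (trans (cong (m +_) (trans (eq₄′ r) r₂≡0)) (trans (+-identityʳ m) (trans m≡n (sym sr)))))
    ... | no x≢r = trans (eq₆ x) (trans (sym (qoff x x≢v x≢r x≢t))
          (trans (eq₄′ x) (trans (poff x x≢v x≢r x≢t) (off₁ x x≢t))))

  eqTest-complete : ∀ {s} → s v ≡ s r → ⟦ eqTest t v r ⟧ s (set s t 0)
  eqTest-complete {s} eq =
    s₁ , clear-complete (set-at s t 0) (set-off s t 0) ,
    s₂ , out-complete (s v) move ,
    s₂ , tz-complete (set₃-v s₁ _ _ _) ,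
    s₂ , tz-complete (set₃-r s₁ _ _ _) ,
    s₁ , back-complete (s v) move ,
    tz-complete (set-at s t 0)
    where
    s₁ = set s t 0
    s₂ = set₃ s₁ 0 0 (s v)
    plus0 : ∀ {a} → a ≡ 0 → s v + a ≡ s v
    plus0 refl = +-identityʳ (s v)
    move : Move (s v) s₁ s₂
    move = trans (set-off s t 0 v v≢t) (sym (plus0 (set₃-v s₁ _ _ _))) ,
           trans (set-off s t 0 r r≢t) (trans (sym eq) (sym (plus0 (set₃-r s₁ _ _ _)))) ,
           trans (set₃-t s₁ _ _ _) (sym (plus0 (set-at s t 0))) ,
           set₃-off s₁ _ _ _

-- Compilation of recursive functions into checking programs

Agree : ℕ → State → State → Set
Agree k s s′ = ∀ x → x < k → s′ x ≡ s x

Agree-trans : ∀ {k s t u} → Agree k s t → Agree k t u → Agree k s u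
Agree-trans p q x x<k = trans (q x x<k) (p x x<k)

Agree-weaken : ∀ {k l s t} → k ≤ l → Agree l s t → Agree k s t
Agree-weaken k≤l p x x<k = p x (<-≤-trans x<k k≤l)

Off⇒Agree : ∀ {k r s t} → k ≤ r → Off r s t → Agree k s t
Off⇒Agree k≤r off x x<k = off x (<⇒≢ (<-≤-trans x<k k≤r))

≗⇒Agree : ∀ {k s t} → (∀ x → t x ≡ s x) → Agree k s t
≗⇒Agree eq x _ = eq x

map-Agree : ∀ {n k s t} {xs : Vec ℕ n} → Allᵛ (_< k) xs → Agree k s t → mapᵛ t xs ≡ mapᵛ s xs
map-Agree [] _ = refl
map-Agree (x<k ∷ xs<k) agr = cong₂ _∷_ (agr _ x<k) (map-Agree xs<k agr)

weaken : ∀ {n k l} {xs : Vec ℕ n} → k ≤ l → Allᵛ (_< k) xs → Allᵛ (_< l) xs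
weaken k≤l = Allᵛ-map (λ x<k → <-≤-trans x<k k≤l)

k≤1+k : ∀ {k} → k ≤ 1 + k
k≤1+k {k} = n≤1+n k
k≤2+k : ∀ {k} → k ≤ 2 + k
k≤2+k {k} = m≤n+m k 2
k≤3+k : ∀ {k} → k ≤ 3 + k
k≤3+k {k} = m≤n+m k 3

-- Registers from k on are scratch space: their final contents are unspecified.
Sound : ∀ {n} → ℕ → PR n → Cmd → Vec ℕ n → ℕ → Set
Sound k f c xs y = ∀ {s s′} → ⟦ c ⟧ s s′ → Agree k s s′ × f [ mapᵛ s xs ]⇓ s y

-- The value is read in register `y` before the run: a program verifies a result already stored
-- there, and `Sound` excludes runs on wrong results.
Complete : ∀ {n} → ℕ → PR n → Cmd → Vec ℕ n → ℕ → Set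
Complete k f c xs y = ∀ {s} → f [ mapᵛ s xs ]⇓ s y → ∃ λ s′ → ⟦ c ⟧ s s′ × Agree k s s′

-- The contents of `x` must survive, so a guessed copy in register `k` is incremented instead.
sucC : ℕ → ℕ → ℕ → Cmd
sucC k x y = havoc k ⨾ eqTest (suc k) k x ⨾ op inc k ⨾ eqTest (suc k) k y

module _ {k x y : ℕ} (x<k : x < k) (y<k : y < k) where
  private
    module X = Three {k} {x} {suc k} (≢-sym (<⇒≢ x<k)) (<⇒≢ ≤-refl) (<⇒≢ (m<n⇒m<1+n x<k))
    module Y = Three {k} {y} {suc k} (≢-sym (<⇒≢ y<k)) (<⇒≢ ≤-refl) (<⇒≢ (m<n⇒m<1+n y<k))

  eqC-sound : ∀ {s s′} → ⟦ havoc k ⨾ eqTest (suc k) k x ⨾ eqTest (suc k) k y ⟧ s s′ →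
              Agree k s s′ × s x ≡ s y
  eqC-sound {s} (s₁ , h , s₂ , e₁ , e₂)
    with off₁ ← havoc-sound h | eq₁ , off₂ ← X.eqTest-sound e₁ | eq₂ , off₃ ← Y.eqTest-sound e₂ =
    Agree-trans agr₁ (Agree-trans agr₂ (Off⇒Agree k≤1+k off₃)) ,
    trans (sym (agr₁ x x<k)) (trans (sym eq₁) (trans (sym (off₂ k (<⇒≢ ≤-refl)))
      (trans eq₂ (trans (agr₂ y y<k) (agr₁ y y<k)))))
    where
    agr₁ : Agree k s s₁
    agr₁ = Off⇒Agree ≤-refl off₁
    agr₂ : Agree k s₁ s₂
    agr₂ = Off⇒Agree k≤1+k off₂

  eqC-complete : ∀ {s} → s x ≡ s y →
    ∃ λ s′ → ⟦ havoc k ⨾ eqTest (suc k) k x ⨾ eqTest (suc k) k y ⟧ s s′ × Agree k s s′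
  eqC-complete {s} eq =
    _ , (s₁ , havoc-complete (set-off s k _) ,
         s₂ , X.eqTest-complete (trans (set-at s k _) (sym (agr₁ x x<k))) ,
         Y.eqTest-complete (trans (set-off s₁ (suc k) 0 k (<⇒≢ ≤-refl))
           (trans (set-at s k _) (trans eq (sym (trans (agr₂ y y<k) (agr₁ y y<k))))))) ,
    Agree-trans agr₁ (Agree-trans agr₂ (Off⇒Agree k≤1+k (set-off s₂ (suc k) 0)))
    where
    s₁ = set s k (s x)
    s₂ = set s₁ (suc k) 0
    agr₁ : Agree k s s₁
    agr₁ = Off⇒Agree ≤-refl (set-off s k _)
    agr₂ : Agree k s₁ s₂
    agr₂ = Off⇒Agree k≤1+k (set-off s₁ (suc k) 0)

  sucC-sound : ∀ {s s′} → ⟦ sucC k x y ⟧ s s′ → Agree k s s′ × suc (s x) ≡ s y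
  sucC-sound {s} (s₁ , h , s₂ , e₁ , s₃ , (i , off) , e₂)
    with off₁ ← havoc-sound h | eq₁ , off₂ ← X.eqTest-sound e₁ | eq₂ , off₃ ← Y.eqTest-sound e₂ =
    Agree-trans agr₁ (Agree-trans agr₂ (Agree-trans agr₃ (Off⇒Agree k≤1+k off₃))) ,
    trans (cong suc (trans (sym (agr₁ x x<k)) (trans (sym eq₁) (sym (off₂ k (<⇒≢ ≤-refl))))))
      (trans (sym i) (trans eq₂ (trans (agr₃ y y<k) (trans (agr₂ y y<k) (agr₁ y y<k)))))
    where
    agr₁ : Agree k s s₁
    agr₁ = Off⇒Agree ≤-refl off₁
    agr₂ : Agree k s₁ s₂
    agr₂ = Off⇒Agree k≤1+k off₂
    agr₃ : Agree k s₂ s₃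
    agr₃ = Off⇒Agree ≤-refl off

  sucC-complete : ∀ {s} → suc (s x) ≡ s y → ∃ λ s′ → ⟦ sucC k x y ⟧ s s′ × Agree k s s′
  sucC-complete {s} eq =
    _ , (s₁ , havoc-complete (set-off s k _) ,
         s₂ , X.eqTest-complete (trans (set-at s k _) (sym (agr₁ x x<k))) ,
         s₃ , (set-at s₂ k _ , set-off s₂ k _) ,
         Y.eqTest-complete (trans (set-at s₂ k _)
           (trans (cong suc (trans (set-off s₁ (suc k) 0 k (<⇒≢ ≤-refl)) (set-at s k _)))
             (trans eq (sym (trans (agr₃ y y<k) (trans (agr₂ y y<k) (agr₁ y y<k)))))))) ,
    Agree-trans agr₁ (Agree-trans agr₂ (Agree-trans agr₃ (Off⇒Agree k≤1+k (set-off s₃ (suc k) 0))))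
    where
    s₁ = set s k (s x)
    s₂ = set s₁ (suc k) 0
    s₃ = set s₂ k (suc (s₂ k))
    agr₁ : Agree k s s₁
    agr₁ = Off⇒Agree ≤-refl (set-off s k _)
    agr₂ : Agree k s₁ s₂
    agr₂ = Off⇒Agree k≤1+k (set-off s₁ (suc k) 0)
    agr₃ : Agree k s₂ s₃
    agr₃ = Off⇒Agree ≤-refl (set-off s₂ k _)

module Recursion {n} {g : PR n} {h : PR (2 + n)} {k : ℕ} {xs : Vec ℕ n} {x y : ℕ}
    (xs<k : Allᵛ (_< k) xs) (x<k : x < k) (y<k : y < k) (cg ch : Cmd) where

  -- Register `k` counts the rounds, `1 + k` holds the value of the recursion at that count, and
  -- `2 + k` receives a guess for the next value, which `ch` verifies before it is copied.
  body : Cmd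
  body = havoc (2 + k) ⨾ ch ⨾ havoc (1 + k) ⨾ eqTest (3 + k) (1 + k) (2 + k) ⨾ op inc k

  init : Cmd
  init = clear k ⨾ havoc (1 + k) ⨾ cg

  -- `star` may stop after any number of rounds; comparing the counter with `x` keeps only the runs
  -- that stop at the right one.
  loop : Cmd
  loop = init ⨾ star body ⨾ eqTest (2 + k) k x ⨾ eqTest (2 + k) (1 + k) y

  private
    module E = Three {1 + k} {2 + k} {3 + k} (<⇒≢ ≤-refl) (<⇒≢ (n≤1+n _)) (<⇒≢ ≤-refl)
    module X = Three {k} {x} {2 + k} (≢-sym (<⇒≢ x<k)) (<⇒≢ (n≤1+n _)) (<⇒≢ (<-≤-trans x<k k≤2+k))
    module Y = Three {1 + k} {y} {2 + k} (≢-sym (<⇒≢ (m<n⇒m<1+n y<k))) (<⇒≢ ≤-refl)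
                     (<⇒≢ (<-≤-trans y<k k≤2+k))
    k<2+k : k < 2 + k
    k<2+k = n≤1+n _
    1+k<2+k : 1 + k < 2 + k
    1+k<2+k = ≤-refl

  module _ (h-sound : Sound (3 + k) h ch (k ∷ 1 + k ∷ xs) (2 + k)) where

    body-sound : ∀ {s s′} → ⟦ body ⟧ s s′ → R g h [ s k ∷ mapᵛ s xs ]⇓ s (1 + k) →
                 Agree k s s′ × R g h [ s′ k ∷ mapᵛ s′ xs ]⇓ s′ (1 + k)
    body-sound {s} {s′} (s₁ , h₁ , s₂ , c , s₃ , h₂ , s₄ , e , i , off₅) r
      with off₁ ← havoc-sound h₁ | agr₂ , h⇓ ← h-sound c | off₃ ← havoc-sound h₂
         | eq , off₄ ← E.eqTest-sound e =
      agr , subst₂ (λ a X → R g h [ a ∷ X ]⇓ s′ (1 + k)) (sym s′k) (sym (map-Agree xs<k agr))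
        (⇓RS r (subst₂ (λ X b → h [ X ]⇓ b) args val h⇓))
      where
      agr₁ : Agree (2 + k) s s₁
      agr₁ = Off⇒Agree ≤-refl off₁
      agr : Agree k s s′
      agr = Agree-trans (Agree-weaken k≤2+k agr₁) (Agree-trans (Agree-weaken k≤3+k agr₂)
        (Agree-trans (Off⇒Agree k≤1+k off₃) (Agree-trans (Off⇒Agree k≤3+k off₄) (Off⇒Agree ≤-refl off₅))))
      s′k : s′ k ≡ suc (s k)
      s′k = trans i (cong suc (trans (off₄ k (<⇒≢ (m<n⇒m<1+n k<2+k))) (trans (off₃ k (<⇒≢ ≤-refl))
        (trans (agr₂ k (m<n⇒m<1+n k<2+k)) (agr₁ k k<2+k)))))
      args : mapᵛ s₁ (k ∷ 1 + k ∷ xs) ≡ s k ∷ s (1 + k) ∷ mapᵛ s xs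
      args = map-Agree (k<2+k ∷ 1+k<2+k ∷ weaken k≤2+k xs<k) agr₁
      val : s₁ (2 + k) ≡ s′ (1 + k)
      val = trans (sym (agr₂ (2 + k) ≤-refl)) (trans (sym (off₃ (2 + k) (≢-sym (<⇒≢ ≤-refl))))
        (trans (sym eq) (trans (sym (off₄ (1 + k) (<⇒≢ (n≤1+n _)))) (sym (off₅ (1 + k) (≢-sym (<⇒≢ ≤-refl)))))))

    star-sound : ∀ {s s′} → ⟦ star body ⟧ s s′ → R g h [ s k ∷ mapᵛ s xs ]⇓ s (1 + k) →
                 Agree k s s′ × R g h [ s′ k ∷ mapᵛ s′ xs ]⇓ s′ (1 + k)
    star-sound {s} {s′} (done eq) r =
      ≗⇒Agree eq , subst₂ (λ X b → R g h [ X ]⇓ b)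
        (sym (map-Agree (k<2+k ∷ weaken k≤2+k xs<k) (≗⇒Agree eq))) (sym (eq (1 + k))) r
    star-sound (step p q) r =
      let agr , r₁ = body-sound p r ; agr′ , r₂ = star-sound q r₁ in Agree-trans agr agr′ , r₂

    loop-sound : Sound (2 + k) g cg xs (1 + k) → Sound k (R g h) loop (x ∷ xs) y
    loop-sound g-sound {s} {s′} (s₃ , (s₁ , cl , s₂ , hv , c) , s₄ , st , s₅ , e₁ , e₂)
      with s₁k≡0 , off₁ ← clear-sound cl | off₂ ← havoc-sound hv | agr₃ , g⇓ ← g-sound c =
      Agree-trans agr₀₃ (Agree-trans agr₄ (Agree-trans agr₅ (Off⇒Agree k≤2+k off₆))) ,
      subst₂ (λ X b → R g h [ X ]⇓ b)
        (cong₂ _∷_ (trans eq₁ (agr₀₄ x x<k)) (map-Agree xs<k agr₀₄))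
        (trans (sym (off₅ (1 + k) (<⇒≢ ≤-refl))) (trans eq₂ (trans (agr₅ y y<k) (agr₀₄ y y<k))))
        (proj₂ st′)
      where
      agr₀₂ : Agree k s s₂
      agr₀₂ = Agree-trans (Off⇒Agree ≤-refl off₁) (Off⇒Agree k≤1+k off₂)
      agr₀₃ : Agree k s s₃
      agr₀₃ = Agree-trans agr₀₂ (Agree-weaken k≤2+k agr₃)
      st′ = star-sound st (subst₂ (λ X b → R g h [ X ]⇓ b)
        (cong₂ _∷_ (sym (trans (agr₃ k k<2+k) (trans (off₂ k (<⇒≢ ≤-refl)) s₁k≡0)))
                   (sym (map-Agree (weaken k≤2+k xs<k) agr₃)))
        (sym (agr₃ (1 + k) 1+k<2+k)) (⇓R0 g⇓))
      agr₄ : Agree k s₃ s₄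
      agr₄ = proj₁ st′
      agr₀₄ : Agree k s s₄
      agr₀₄ = Agree-trans agr₀₃ agr₄
      eq₁ = proj₁ (X.eqTest-sound e₁)
      off₅ = proj₂ (X.eqTest-sound e₁)
      agr₅ : Agree k s₄ s₅
      agr₅ = Off⇒Agree k≤2+k off₅
      eq₂ = proj₁ (Y.eqTest-sound e₂)
      off₆ = proj₂ (Y.eqTest-sound e₂)

  module _ (g-complete : Complete (2 + k) g cg xs (1 + k))
           (h-complete : Complete (3 + k) h ch (k ∷ 1 + k ∷ xs) (2 + k)) where

    body-complete : ∀ {s b} → h [ s k ∷ s (1 + k) ∷ mapᵛ s xs ]⇓ b →
      ∃ λ s′ → ⟦ body ⟧ s s′ × Agree k s s′ × s′ k ≡ suc (s k) × s′ (1 + k) ≡ b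
    body-complete {s} {b} h⇓ =
      let s₁ = set s (2 + k) b
          agr₁ = Off⇒Agree {2 + k} ≤-refl (set-off s (2 + k) b)
          s₂ , c , agr₂ = h-complete {s₁} (subst₂ (λ X b → h [ X ]⇓ b)
            (sym (map-Agree (k<2+k ∷ 1+k<2+k ∷ weaken k≤2+k xs<k) agr₁)) (sym (set-at s (2 + k) b)) h⇓)
          s₃ = set s₂ (1 + k) b
          off₃ = set-off s₂ (1 + k) b
          s₄ = set s₃ (3 + k) 0
          off₄ = set-off s₃ (3 + k) 0
          s₅ = set s₄ k (suc (s₄ k))
          off₅ = set-off s₄ k _
      in s₅ ,
         (s₁ , havoc-complete (set-off s (2 + k) b) , s₂ , c , s₃ , havoc-complete off₃ ,
          s₄ , E.eqTest-complete (trans (set-at s₂ (1 + k) b)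
                 (sym (trans (off₃ (2 + k) (≢-sym (<⇒≢ ≤-refl)))
                        (trans (agr₂ (2 + k) ≤-refl) (set-at s (2 + k) b))))) ,
          set-at s₄ k _ , off₅) ,
         Agree-trans (Agree-weaken k≤2+k agr₁) (Agree-trans (Agree-weaken k≤3+k agr₂)
           (Agree-trans (Off⇒Agree k≤1+k off₃) (Agree-trans (Off⇒Agree k≤3+k off₄) (Off⇒Agree ≤-refl off₅)))) ,
         trans (set-at s₄ k _) (cong suc (trans (off₄ k (<⇒≢ (m<n⇒m<1+n k<2+k)))
           (trans (off₃ k (<⇒≢ ≤-refl)) (trans (agr₂ k (m<n⇒m<1+n k<2+k)) (agr₁ k k<2+k))))) ,
         trans (off₅ (1 + k) (≢-sym (<⇒≢ ≤-refl))) (trans (off₄ (1 + k) (<⇒≢ (n≤1+n _))) (set-at s₂ (1 + k) b))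

    -- A derivation for `R g h` unfolds from its last round, so the star is extended at its end by
    -- `Star-snoc`. The initialisation precedes the star and is returned separately.
    star-complete : ∀ {s a b} → R g h [ a ∷ mapᵛ s xs ]⇓ b →
      ∃ λ s₁ → ∃ λ s′ → ⟦ init ⟧ s s₁ × ⟦ star body ⟧ s₁ s′ × Agree k s s′ × s′ k ≡ a × s′ (1 + k) ≡ b
    star-complete {s} {zero} {b} (⇓R0 g⇓) =
      let s₁ = set s k 0
          off₁ = set-off s k 0
          s₂ = set s₁ (1 + k) b
          off₂ = set-off s₁ (1 + k) b
          agr₀₂ = Agree-trans {k} (Off⇒Agree ≤-refl off₁) (Off⇒Agree k≤1+k off₂)
          s₃ , c , agr₃ = g-complete {s₂} (subst₂ (λ X b → g [ X ]⇓ b)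
            (sym (map-Agree xs<k agr₀₂)) (sym (set-at s₁ (1 + k) b)) g⇓)
      in s₃ , s₃ , (s₁ , clear-complete (set-at s k 0) off₁ , s₂ , havoc-complete off₂ , c) ,
         done (λ _ → refl) , Agree-trans agr₀₂ (Agree-weaken k≤2+k agr₃) ,
         trans (agr₃ k k<2+k) (trans (off₂ k (<⇒≢ ≤-refl)) (set-at s k 0)) ,
         trans (agr₃ (1 + k) 1+k<2+k) (set-at s₁ (1 + k) b)
    star-complete {s} {suc a} {b} (⇓RS r h⇓) =
      let s₁ , s₂ , i , st , agr , eqk , eqr = star-complete {s} r
          s₃ , bd , agr′ , eqk′ , eqr′ = body-complete {s₂} (subst (λ X → h [ X ]⇓ b)
            (sym (cong₂ _∷_ eqk (cong₂ _∷_ eqr (map-Agree xs<k agr)))) h⇓)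
      in s₁ , s₃ , i , Star-snoc (⟦⟧-respˡ body) st bd , Agree-trans agr agr′ ,
         trans eqk′ (cong suc eqk) , eqr′

    loop-complete : Complete k (R g h) loop (x ∷ xs) y
    loop-complete {s} r =
      let s₁ , s₂ , i , st , agr , eqk , eqr = star-complete {s} r
          s₃ = set s₂ (2 + k) 0
          off₃ = set-off s₂ (2 + k) 0
          agr₃ = Off⇒Agree k≤2+k off₃
      in _ , (s₁ , i , s₂ , st , s₃ , X.eqTest-complete (trans eqk (sym (agr x x<k))) ,
              Y.eqTest-complete (trans (off₃ (1 + k) (<⇒≢ ≤-refl))
                (trans eqr (sym (trans (agr₃ y y<k) (agr y y<k)))))) ,
         Agree-trans agr (Agree-trans agr₃ (Off⇒Agree k≤2+k (set-off s₃ (2 + k) 0)))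

module Minimisation {n} {f : PR (suc n)} {k : ℕ} {xs : Vec ℕ n} {y : ℕ}
    (xs<k : Allᵛ (_< k) xs) (y<k : y < k) (cs cy : Cmd) where

  -- Register `1 + k` guesses the value of `f` at the candidate in register `k`. Decrementing it is
  -- possible only for a positive value, so the candidate never passes a zero of `f` or an argument
  -- where `f` is undefined.
  body : Cmd
  body = havoc (1 + k) ⨾ cs ⨾ op dec (1 + k) ⨾ op inc k

  search : Cmd
  search = clear k ⨾ star body ⨾ eqTest (2 + k) k y ⨾ havoc (1 + k) ⨾ cy ⨾ op tz (1 + k)

  private
    module Y = Three {k} {y} {2 + k} (≢-sym (<⇒≢ y<k)) (<⇒≢ (n≤1+n _)) (<⇒≢ (<-≤-trans y<k k≤2+k))
    k<2+k : k < 2 + k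
    k<2+k = n≤1+n _
    1+k<2+k : 1 + k < 2 + k
    1+k<2+k = ≤-refl

  Positive : Vec ℕ n → ℕ → Set
  Positive X b = ∀ z → z < b → ∃ λ w → f [ z ∷ X ]⇓ suc w

  positive-suc : ∀ {X b w} → Positive X b → f [ b ∷ X ]⇓ suc w → Positive X (suc b)
  positive-suc {b = b} ps p z (s≤s z≤b) with z ≟ b
  ... | yes refl = _ , p
  ... | no z≢b = ps z (≤∧≢⇒< z≤b z≢b)

  module _ (s-sound : Sound (2 + k) f cs (k ∷ xs) (1 + k)) where

    body-sound : ∀ {s s′} → ⟦ body ⟧ s s′ → Positive (mapᵛ s xs) (s k) →
                 Agree k s s′ × Positive (mapᵛ s′ xs) (s′ k)
    body-sound {s} {s′} (s₁ , hv , s₂ , c , s₃ , (d , off₃) , i , off₄) ps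
      with off₁ ← havoc-sound hv | agr₂ , f⇓ ← s-sound c =
      agr , subst₂ Positive (sym (map-Agree xs<k agr)) (sym s′k)
        (positive-suc ps (subst₂ (λ X b → f [ X ]⇓ b)
          (map-Agree (≤-refl ∷ weaken k≤1+k xs<k) (Off⇒Agree ≤-refl off₁))
          (trans (sym (agr₂ (1 + k) 1+k<2+k)) d) f⇓))
      where
      agr : Agree k s s′
      agr = Agree-trans (Off⇒Agree k≤1+k off₁) (Agree-trans (Agree-weaken k≤2+k agr₂)
        (Agree-trans (Off⇒Agree k≤1+k off₃) (Off⇒Agree ≤-refl off₄)))
      s′k : s′ k ≡ suc (s k)
      s′k = trans i (cong suc (trans (off₃ k (<⇒≢ ≤-refl)) (trans (agr₂ k k<2+k) (off₁ k (<⇒≢ ≤-refl)))))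

    star-sound : ∀ {s s′} → ⟦ star body ⟧ s s′ → Positive (mapᵛ s xs) (s k) →
                 Agree k s s′ × Positive (mapᵛ s′ xs) (s′ k)
    star-sound (done eq) ps =
      ≗⇒Agree eq , subst₂ Positive (sym (map-Agree xs<k (≗⇒Agree eq))) (sym (eq k)) ps
    star-sound (step p q) ps =
      let agr , ps₁ = body-sound p ps ; agr′ , ps₂ = star-sound q ps₁ in Agree-trans agr agr′ , ps₂

    search-sound : Sound (2 + k) f cy (y ∷ xs) (1 + k) → Sound k (M f) search xs y
    search-sound y-sound {s} {s′} (s₁ , cl , s₂ , st , s₃ , e , s₄ , hv , s₅ , c , z)
      with s₁k≡0 , off₁ ← clear-sound cl | eq , off₃ ← Y.eqTest-sound e | off₄ ← havoc-sound hv
         | agr₅ , f⇓ ← y-sound c | zero₅ , eq₆ ← tz-sound z =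
      Agree-trans agr₀₄ (Agree-trans (Agree-weaken k≤2+k agr₅) (≗⇒Agree eq₆)) ,
      ⇓M (subst₂ (λ X b → f [ X ]⇓ b) (map-Agree (y<k ∷ xs<k) agr₀₄)
           (trans (sym (agr₅ (1 + k) 1+k<2+k)) zero₅) f⇓)
         (subst₂ Positive (map-Agree xs<k agr₀₂) (trans eq (agr₀₂ y y<k)) (proj₂ st′))
      where
      st′ = star-sound st λ z z<s₁k → ⊥-elim (n≮0 (subst (z <_) s₁k≡0 z<s₁k))
      agr₀₂ : Agree k s s₂
      agr₀₂ = Agree-trans (Off⇒Agree ≤-refl off₁) (proj₁ st′)
      agr₀₄ : Agree k s s₄
      agr₀₄ = Agree-trans agr₀₂ (Agree-trans (Off⇒Agree k≤2+k off₃) (Off⇒Agree k≤1+k off₄))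

  module _ (s-complete : Complete (2 + k) f cs (k ∷ xs) (1 + k)) where

    body-complete : ∀ {s w} → f [ s k ∷ mapᵛ s xs ]⇓ suc w →
      ∃ λ s′ → ⟦ body ⟧ s s′ × Agree k s s′ × s′ k ≡ suc (s k)
    body-complete {s} {w} f⇓ =
      let s₁ = set s (1 + k) (suc w)
          off₁ = set-off s (1 + k) (suc w)
          s₂ , c , agr₂ = s-complete {s₁} (subst₂ (λ X b → f [ X ]⇓ b)
            (sym (map-Agree (≤-refl ∷ weaken k≤1+k xs<k) (Off⇒Agree ≤-refl off₁)))
            (sym (set-at s (1 + k) (suc w))) f⇓)
          s₃ = set s₂ (1 + k) w
          off₃ = set-off s₂ (1 + k) w
          s₄ = set s₃ k (suc (s₃ k))
          off₄ = set-off s₃ k _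
      in s₄ ,
         (s₁ , havoc-complete off₁ , s₂ , c ,
          s₃ , (trans (agr₂ (1 + k) 1+k<2+k) (trans (set-at s (1 + k) (suc w))
                 (cong suc (sym (set-at s₂ (1 + k) w)))) , off₃) ,
          set-at s₃ k _ , off₄) ,
         Agree-trans (Off⇒Agree k≤1+k off₁) (Agree-trans (Agree-weaken k≤2+k agr₂)
           (Agree-trans (Off⇒Agree k≤1+k off₃) (Off⇒Agree ≤-refl off₄))) ,
         trans (set-at s₃ k _) (cong suc (trans (off₃ k (<⇒≢ ≤-refl))
           (trans (agr₂ k k<2+k) (off₁ k (<⇒≢ ≤-refl)))))

    star-complete : ∀ b {s} → s k ≡ 0 → Positive (mapᵛ s xs) b →
      ∃ λ s′ → ⟦ star body ⟧ s s′ × Agree k s s′ × s′ k ≡ b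
    star-complete zero {s} eq _ = s , done (λ _ → refl) , (λ _ _ → refl) , eq
    star-complete (suc b) {s} eq ps =
      let s₁ , st , agr , eqk = star-complete b {s} eq (λ z z<b → ps z (m<n⇒m<1+n z<b))
          w , f⇓ = ps b ≤-refl
          s₂ , bd , agr′ , eqk′ = body-complete {s₁} {w} (subst (λ X → f [ X ]⇓ suc w)
            (sym (cong₂ _∷_ eqk (map-Agree xs<k agr))) f⇓)
      in s₂ , Star-snoc (⟦⟧-respˡ body) st bd , Agree-trans agr agr′ , trans eqk′ (cong suc eqk)

    search-complete : Complete (2 + k) f cy (y ∷ xs) (1 + k) → Complete k (M f) search xs y
    search-complete y-complete {s} (⇓M f⇓ ps) =
      let s₁ = set s k 0
          off₁ = set-off s k 0
          agr₁ = Off⇒Agree ≤-refl off₁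
          s₂ , st , agr₂ , eqk = star-complete (s y) {s₁} (set-at s k 0)
            (subst (λ X → Positive X (s y)) (sym (map-Agree xs<k agr₁)) ps)
          s₃ = set s₂ (2 + k) 0
          s₄ = set s₃ (1 + k) 0
          agr₀₂ = Agree-trans agr₁ agr₂
          agr₀₄ = Agree-trans agr₀₂ (Agree-trans (Off⇒Agree k≤2+k (set-off s₂ (2 + k) 0))
                                                 (Off⇒Agree k≤1+k (set-off s₃ (1 + k) 0)))
          s₅ , c , agr₅ = y-complete {s₄} (subst₂ (λ X b → f [ X ]⇓ b)
            (sym (map-Agree (y<k ∷ xs<k) agr₀₄)) (sym (set-at s₃ (1 + k) 0)) f⇓)
      in s₅ ,
         (s₁ , clear-complete (set-at s k 0) off₁ , s₂ , st ,
          s₃ , Y.eqTest-complete (trans eqk (sym (agr₀₂ y y<k))) ,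
          s₄ , havoc-complete (set-off s₃ (1 + k) 0) , s₅ , c ,
          tz-complete (trans (agr₅ (1 + k) 1+k<2+k) (set-at s₃ (1 + k) 0))) ,
         Agree-trans agr₀₄ (Agree-weaken k≤2+k agr₅)

range : ℕ → (m : ℕ) → Vec ℕ m
range j zero = []
range j (suc m) = j ∷ range (suc j) m

range-head : ∀ {j m K} → j + suc m ≤ K → j < K
range-head {j} {m} le = ≤-trans (≤-reflexive (+-comm 1 j)) (≤-trans (+-monoʳ-≤ j (s≤s z≤n)) le)

range-tail : ∀ {j m K} → j + suc m ≤ K → suc j + m ≤ K
range-tail {j} {m} le = ≤-trans (≤-reflexive (sym (+-suc j m))) le

range< : ∀ j m {K} → j + m ≤ K → Allᵛ (_< K) (range j m)
range< j zero _ = []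
range< j (suc m) le = range-head le ∷ range< (suc j) m (range-tail le)

mutual
  -- For a composition the `m` intermediate values are guessed in registers `k` to `k + m - 1`, and
  -- scratch space begins at `k + m`. The clauses for `R` and `M` are `loop` and `search` of the two
  -- modules above, written out.
  graph : ∀ {n} → ℕ → PR n → Vec ℕ n → ℕ → Cmd
  graph k Z xs y = op tz y
  graph k S (x ∷ []) y = sucC k x y
  graph k (P i) xs y = havoc k ⨾ eqTest (suc k) k (lookup xs i) ⨾ eqTest (suc k) k y
  graph k (C {m} f gs) xs y = graphs (k + m) gs xs k (graph (k + m) f (range k m) y)
  graph k (R g h) (x ∷ xs) y =
    (clear k ⨾ havoc (1 + k) ⨾ graph (2 + k) g xs (1 + k)) ⨾
    star (havoc (2 + k) ⨾ graph (3 + k) h (k ∷ 1 + k ∷ xs) (2 + k) ⨾ havoc (1 + k) ⨾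
          eqTest (3 + k) (1 + k) (2 + k) ⨾ op inc k) ⨾
    eqTest (2 + k) k x ⨾ eqTest (2 + k) (1 + k) y
  graph k (M f) xs y =
    clear k ⨾
    star (havoc (1 + k) ⨾ graph (2 + k) f (k ∷ xs) (1 + k) ⨾ op dec (1 + k) ⨾ op inc k) ⨾
    eqTest (2 + k) k y ⨾ havoc (1 + k) ⨾ graph (2 + k) f (y ∷ xs) (1 + k) ⨾ op tz (1 + k)

  graphs : ∀ {m n} → ℕ → Vec (PR n) m → Vec ℕ n → ℕ → Cmd → Cmd
  graphs K [] xs j c = c
  graphs K (g ∷ gs) xs j c = havoc j ⨾ graph K g xs j ⨾ graphs K gs xs (suc j) c

mutual
  graph-sound : ∀ {n} k (f : PR n) {xs y} → Allᵛ (_< k) xs → y < k → Sound k f (graph k f xs y) xs y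
  graph-sound k Z {xs} xs<k y<k {s} z with eq , eq′ ← tz-sound z =
    ≗⇒Agree eq′ , subst (Z [ mapᵛ s xs ]⇓_) (sym eq) ⇓Z
  graph-sound k S {x ∷ []} (x<k ∷ []) y<k {s} p with agr , eq ← sucC-sound x<k y<k p =
    agr , subst (S [ s x ∷ [] ]⇓_) eq ⇓S
  graph-sound k (P i) {xs} xs<k y<k {s} p with agr , eq ← eqC-sound (lookup⁺ xs<k i) y<k p =
    agr , subst (P i [ mapᵛ s xs ]⇓_) (trans (lookup-map i s xs) eq) ⇓P
  graph-sound k (C {m} f gs) {y = y} xs<k y<k {s} p
    with t , agr , gs⇓ , q ← graphs-sound (k + m) gs k ≤-refl xs<k p
    with agr′ , f⇓ ← graph-sound (k + m) f (range< k m ≤-refl) (<-≤-trans y<k (m≤m+n k m)) q =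
    Agree-trans agr (Agree-weaken (m≤m+n k m) agr′) ,
    ⇓C gs⇓ (subst (f [ _ ]⇓_) (agr y y<k) f⇓)
  graph-sound k (R g h) {x ∷ xs} (x<k ∷ xs<k) y<k =
    loop-sound (graph-sound (3 + k) h (m≤n+m (suc k) 2 ∷ n≤1+n _ ∷ weaken k≤3+k xs<k) ≤-refl)
               (graph-sound (2 + k) g (weaken k≤2+k xs<k) ≤-refl)
    where open Recursion {g = g} {h} xs<k x<k y<k _ _
  graph-sound k (M f) xs<k y<k =
    search-sound (graph-sound (2 + k) f (n≤1+n _ ∷ weaken k≤2+k xs<k) ≤-refl)
                 (graph-sound (2 + k) f (<-≤-trans y<k k≤2+k ∷ weaken k≤2+k xs<k) ≤-refl)
    where open Minimisation {f = f} xs<k y<k _ _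

  graphs-sound : ∀ {m n} K (gs : Vec (PR n) m) {xs} j {c s s′} → j + m ≤ K → Allᵛ (_< j) xs →
    ⟦ graphs K gs xs j c ⟧ s s′ →
    ∃ λ t → Agree j s t × gs [ mapᵛ s xs ]⇓* mapᵛ t (range j m) × ⟦ c ⟧ t s′
  graphs-sound K [] j _ _ p = _ , (λ _ _ → refl) , [] , p
  graphs-sound {suc m} K (g ∷ gs) j le xs<j (s₁ , hv , s₂ , p , q)
    with off ← havoc-sound hv
       | agr , g⇓ ← graph-sound K g (weaken (≤-trans (m≤m+n j _) le) xs<j) (range-head le) p
       | t , agr′ , gs⇓ , r ← graphs-sound K gs (suc j) (range-tail le) (weaken k≤1+k xs<j) q =
    t , Agree-trans agr₀₂ (Agree-weaken k≤1+k agr′) ,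
    subst₂ (λ X b → g [ X ]⇓ b) (map-Agree xs<j agr₀₁)
      (sym (trans (agr′ j ≤-refl) (agr j (range-head le)))) g⇓ ∷
    subst (gs [_]⇓* _) (map-Agree xs<j agr₀₂) gs⇓ , r
    where
    agr₀₁ = Off⇒Agree ≤-refl off
    agr₀₂ = Agree-trans agr₀₁ (Agree-weaken (≤-trans (m≤m+n j _) le) agr)

mutual
  graph-complete : ∀ {n} k (f : PR n) {xs y} → Allᵛ (_< k) xs → y < k → Complete k f (graph k f xs y) xs y
  graph-complete k Z xs<k y<k {s} z = s , tz-complete (⇓-deterministic z ⇓Z) , λ _ _ → refl
  graph-complete k S (x<k ∷ []) y<k p = sucC-complete x<k y<k (⇓-deterministic ⇓S p)
  graph-complete k (P i) {xs} xs<k y<k {s} p =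
    eqC-complete (lookup⁺ xs<k i) y<k (trans (sym (lookup-map i s xs)) (⇓-deterministic ⇓P p))
  graph-complete k (C {m} f gs) {y = y} xs<k y<k {s} (⇓C gs⇓ f⇓)
    with t , cont , agr , eq ← graphs-complete (k + m) gs k ≤-refl xs<k gs⇓
    with s′ , q , agr′ ← graph-complete (k + m) f (range< k m ≤-refl) (<-≤-trans y<k (m≤m+n k m)) {t}
                           (subst₂ (λ X b → f [ X ]⇓ b) (sym eq) (sym (agr y y<k)) f⇓) =
    s′ , cont q , Agree-trans agr (Agree-weaken (m≤m+n k m) agr′)
  graph-complete k (R g h) {x ∷ xs} (x<k ∷ xs<k) y<k =
    loop-complete (graph-complete (2 + k) g (weaken k≤2+k xs<k) ≤-refl)
      (graph-complete (3 + k) h (m≤n+m (suc k) 2 ∷ n≤1+n _ ∷ weaken k≤3+k xs<k) ≤-refl)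
    where open Recursion {g = g} {h} xs<k x<k y<k _ _
  graph-complete k (M f) xs<k y<k =
    search-complete (graph-complete (2 + k) f (n≤1+n _ ∷ weaken k≤2+k xs<k) ≤-refl)
      (graph-complete (2 + k) f (<-≤-trans y<k k≤2+k ∷ weaken k≤2+k xs<k) ≤-refl)
    where open Minimisation {f = f} xs<k y<k _ _

  -- A run of the continuation `c` exists only once all intermediate values are in place, so the
  -- part before it is returned as a function on runs.
  graphs-complete : ∀ {m n} K (gs : Vec (PR n) m) {xs} j {s ys} → j + m ≤ K → Allᵛ (_< j) xs →
    gs [ mapᵛ s xs ]⇓* ys →
    ∃ λ t → (∀ {c s′} → ⟦ c ⟧ t s′ → ⟦ graphs K gs xs j c ⟧ s s′) × Agree j s t × mapᵛ t (range j m) ≡ ys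
  graphs-complete K [] j {s} _ _ [] = s , (λ p → p) , (λ _ _ → refl) , refl
  graphs-complete {suc m} K (g ∷ gs) j {s} {y ∷ ys} le xs<j (g⇓ ∷ gs⇓)
    with agr₀₁ ← Off⇒Agree {j} ≤-refl (set-off s j y)
    with s₂ , p , agr ← graph-complete K g (weaken (≤-trans (m≤m+n j _) le) xs<j) (range-head le) {set s j y}
           (subst₂ (λ X b → g [ X ]⇓ b) (sym (map-Agree xs<j agr₀₁)) (sym (set-at s j y)) g⇓)
    with agr₀₂ ← Agree-trans agr₀₁ (Agree-weaken (≤-trans (m≤m+n j _) le) agr)
    with t , cont , agr′ , eq ← graphs-complete K gs (suc j) {s₂} (range-tail le) (weaken k≤1+k xs<j)
           (subst (gs [_]⇓* ys) (sym (map-Agree xs<j agr₀₂)) gs⇓) =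
    t , (λ q → set s j y , havoc-complete (set-off s j y) , s₂ , p , cont q) ,
    Agree-trans agr₀₂ (Agree-weaken k≤1+k agr′) ,
    cong₂ _∷_ (trans (agr′ j ≤-refl) (trans (agr j (range-head le)) (set-at s j y))) eq

-- Execution as simultaneous suffix rewriting

Word : Set
Word = List ℕ

-- A rule τ rewrites, simultaneously in all N components, a suffix pre τ i into post τ i.
module _ (N : ℕ) (pre post : ℕ → ℕ → Word) (Ok : ℕ → (ℕ → Word) → Set) where

  data Run (v : ℕ → Word) : Set where
    done : (∀ i → i < N → v i ≡ 0 ∷ []) → Run v
    step : ∀ τ (w v′ : ℕ → Word) → Ok τ v′ →
           (∀ i → i < N → v i ≡ w i ++ pre τ i) →
           (∀ i → i < N → v′ i ≡ w i ++ post τ i) →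
           Run v′ → Run v

  Run-resp : ∀ {v v′} → (∀ i → v′ i ≡ v i) → Run v → Run v′
  Run-resp eq (done p) = done λ i i<N → trans (eq i) (p i i<N)
  Run-resp eq (step τ w u ok p q r) = step τ w u ok (λ i i<N → trans (eq i) (p i i<N)) q r

nth : ∀ {A : Set} → A → List A → ℕ → A
nth d [] _ = d
nth d (x ∷ xs) zero = x
nth d (x ∷ xs) (suc i) = nth d xs i

nth-All : ∀ {A : Set} {P : A → Set} {d xs} → P d → All P xs → ∀ i → P (nth d xs i)
nth-All pd [] i = pd
nth-All pd (px ∷ pxs) zero = px
nth-All pd (px ∷ pxs) (suc i) = nth-All pd pxs i

∈⇒nth : ∀ {A : Set} {d x : A} {xs} → x ∈ xs → ∃ λ i → i < length xs × nth d xs i ≡ x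
∈⇒nth (here refl) = 0 , s≤s z≤n , refl
∈⇒nth (there x∈xs) = let i , i< , eq = ∈⇒nth x∈xs in suc i , s≤s i< , eq

-- Commands as letters, configurations as words

opTag : Op → ℕ
opTag inc = 0
opTag dec = 1
opTag tz = 2

tagC argC : Cmd → ℕ
codeC : Cmd → ℕ
tagC (op o r) = opTag o
tagC (c ⨾ d) = 3
tagC (star c) = 4
argC (op o r) = r
argC (c ⨾ d) = ⟨ codeC c , codeC d ⟩
argC (star c) = codeC c
codeC (op o r) = ⟨ opTag o , r ⟩
codeC (c ⨾ d) = ⟨ 3 , ⟨ codeC c , codeC d ⟩ ⟩
codeC (star c) = ⟨ 4 , codeC c ⟩

codeC≡ : ∀ c → codeC c ≡ ⟨ tagC c , argC c ⟩
codeC≡ (op _ _) = refl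
codeC≡ (_ ⨾ _) = refl
codeC≡ (star _) = refl

mutual
  codeC-injective : ∀ c d → codeC c ≡ codeC d → c ≡ d
  codeC-injective c d eq = byTagC c d (tag≡ eq′) (arg≡ {tagC c} {_} {tagC d} eq′)
    where eq′ = trans (sym (codeC≡ c)) (trans eq (codeC≡ d))

  byTagC : ∀ c d → tagC c ≡ tagC d → argC c ≡ argC d → c ≡ d
  byTagC (op inc r) (op inc _) _ eq = cong (op inc) eq
  byTagC (op dec r) (op dec _) _ eq = cong (op dec) eq
  byTagC (op tz r) (op tz _) _ eq = cong (op tz) eq
  byTagC (op inc r) (_ ⨾ _) ()
  byTagC (op dec r) (_ ⨾ _) ()
  byTagC (op tz r) (_ ⨾ _) ()
  byTagC (op inc r) (star _) ()
  byTagC (op dec r) (star _) ()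
  byTagC (op tz r) (star _) ()
  byTagC (_ ⨾ _) (op inc _) ()
  byTagC (_ ⨾ _) (op dec _) ()
  byTagC (_ ⨾ _) (op tz _) ()
  byTagC (star _) (op inc _) ()
  byTagC (star _) (op dec _) ()
  byTagC (star _) (op tz _) ()
  byTagC (a ⨾ b) (c ⨾ d) _ eq =
    cong₂ _⨾_ (codeC-injective a c (tag≡ eq)) (codeC-injective b d (arg≡ {codeC a} {_} {codeC c} eq))
  byTagC (star c) (star d) _ eq = cong star (codeC-injective c d eq)

-- Component 0 is the stack of pending commands (top at the end), component 1 + x the
-- register x in unary; the letter 0 marks the bottom of each of them.
letterOf : Cmd → ℕ
letterOf c = 2 + codeC c

stackW : List Cmd → Word
stackW [] = 0 ∷ []
stackW (c ∷ cs) = stackW cs ∷ʳ letterOf c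

regW : ℕ → Word
regW zero = 0 ∷ []
regW (suc n) = regW n ∷ʳ 1

conf : List Cmd → State → ℕ → Word
conf cs s zero = stackW cs
conf cs s (suc x) = regW (s x)

stackW-pop : ∀ c cs {u} → stackW cs ≡ u ∷ʳ letterOf c → ∃ λ cs′ → cs ≡ c ∷ cs′ × u ≡ stackW cs′
stackW-pop _ [] {u} eq with _ , () ← ∷ʳ-injective [] u eq
stackW-pop d (c ∷ cs) {u} eq with eq₁ , eq₂ ← ∷ʳ-injective (stackW cs) u eq
  with refl ← codeC-injective c d (+-cancelˡ-≡ 2 _ _ eq₂) = cs , refl , sym eq₁

stackW-empty : ∀ cs {u} → stackW cs ≡ u ∷ʳ 0 → cs ≡ []
stackW-empty [] _ = refl
stackW-empty (c ∷ cs) {u} eq with _ , () ← ∷ʳ-injective (stackW cs) u eq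

-- The bottom marker is the first letter of a register word, so `0` is a suffix exactly when the
-- register is zero. This makes the zero test a suffix replacement.
before after : Op → Word
before inc = []
before dec = 1 ∷ []
before tz = 0 ∷ []
after inc = 1 ∷ []
after dec = []
after tz = 0 ∷ []

op-sound : ∀ o a {u} → regW a ≡ u ++ before o → ∃ λ b → OpRel o a b × u ++ after o ≡ regW b
op-sound inc a {u} eq = suc a , refl , cong (_∷ʳ 1) (trans (sym (++-identityʳ u)) (sym eq))
op-sound dec zero {u} eq with _ , () ← ∷ʳ-injective [] u eq
op-sound dec (suc a) {u} eq = a , refl , trans (++-identityʳ u) (sym (proj₁ (∷ʳ-injective (regW a) u eq)))
op-sound tz zero eq = 0 , (refl , refl) , sym eq
op-sound tz (suc a) {u} eq with _ , () ← ∷ʳ-injective (regW a) u eq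

op-complete : ∀ o {a b} → OpRel o a b → ∃ λ u → regW a ≡ u ++ before o × regW b ≡ u ++ after o
op-complete inc {a} refl = regW a , sym (++-identityʳ _) , refl
op-complete dec {b = b} refl = regW b , refl , sym (++-identityʳ _)
op-complete tz (refl , refl) = [] , refl , refl

-- The first four constructors execute the command on top of the stack. `drain` serves after the
-- program has ended: `done` demands one fixed final configuration, and the scratch registers may
-- contain anything.
data Rule : Set where
  exec  : Op → ℕ → Rule
  unseq : Cmd → Cmd → Rule
  stop  : Cmd → Rule
  again : Cmd → Rule
  drain : ℕ → Rule

only : ℕ → Word → ℕ → Word
only r u x with x ≟ r
... | yes _ = u
... | no  _ = []

only-at : ∀ r u → only r u r ≡ u
only-at r u with r ≟ r
... | yes _ = refl
... | no r≢r = ⊥-elim (r≢r refl)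

preR postR : Rule → ℕ → Word
preR (exec o r) zero = letterOf (op o r) ∷ []
preR (exec o r) (suc x) = only r (before o) x
preR (unseq c d) zero = letterOf (c ⨾ d) ∷ []
preR (stop c) zero = letterOf (star c) ∷ []
preR (again c) zero = letterOf (star c) ∷ []
preR (drain r) zero = 0 ∷ []
preR (drain r) (suc x) = only r (before dec) x
preR _ (suc x) = []
postR (exec o r) zero = []
postR (exec o r) (suc x) = only r (after o) x
postR (unseq c d) zero = letterOf d ∷ letterOf c ∷ []
postR (stop c) zero = []
postR (again c) zero = letterOf (star c) ∷ letterOf c ∷ []
postR (drain r) zero = 0 ∷ []
postR (drain r) (suc x) = only r (after dec) x
postR _ (suc x) = []

need : Rule → ℕ
need (exec o r) = suc r
need _ = 0

rulesOf : Cmd → List Rule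
rulesOf (op o r) = exec o r ∷ []
rulesOf (c ⨾ d) = unseq c d ∷ rulesOf c ++ rulesOf d
rulesOf (star c) = stop c ∷ again c ∷ rulesOf c

headOf : Rule → Cmd
headOf (exec o r) = op o r
headOf (unseq c d) = c ⨾ d
headOf (stop c) = star c
headOf (again c) = star c
headOf (drain r) = op dec r

need≤sum : ∀ ρs → All (λ ρ → need ρ ≤ sum (map need ρs)) ρs
need≤sum [] = []
need≤sum (ρ ∷ ρs) = m≤m+n _ _ ∷ All.map (λ le → ≤-trans le (m≤n+m _ (need ρ))) (need≤sum ρs)

-- The promise carried by a configuration. Soundness goes backwards along a run: an empty stack
-- promises nothing, and each step passes the promise to the configuration before it.
Pending : List Cmd → State → Set
Pending [] s = ⊤
Pending (c ∷ cs) s = ∃ λ s′ → ⟦ c ⟧ s s′ × Pending cs s′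

module Machine (c₀ : Cmd) where

  -- The sum is a coarse upper bound for the registers mentioned by `exec` rules, used in place of
  -- their maximum.
  registers : ℕ
  registers = sum (map need (rulesOf c₀))

  components : ℕ
  components = suc registers

  rules : List Rule
  rules = rulesOf c₀ ++ map drain (upTo registers)

  -- An index beyond the list gives `stop c₀`, which is sound like any `stop`. Runs read off from a
  -- solution therefore need no bound on their rule indices.
  rule : ℕ → Rule
  rule = nth (stop c₀) rules

  pre post : ℕ → ℕ → Word
  pre τ = preR (rule τ)
  post τ = postR (rule τ)

  alphabet : List ℕ
  alphabet = 0 ∷ 1 ∷ map (λ ρ → letterOf (headOf ρ)) (rulesOf c₀)

  -- The bounds that a run must respect to become a solution: the matrix can list equations for
  -- finitely many rules and letters only.
  Ok : ℕ → (ℕ → Word) → Set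
  Ok τ v = τ < length rules × (∀ i → All (_∈ alphabet) (v i))

  need-rule : ∀ τ → need (rule τ) ≤ registers
  need-rule = nth-All z≤n (++⁺ (need≤sum (rulesOf c₀)) (map⁺ (universal (λ _ → z≤n) (upTo registers))))

  _≐ᶜ_ : (ℕ → Word) → (ℕ → Word) → Set
  v ≐ᶜ v′ = ∀ i → i < components → v i ≡ v′ i

  -- A step on the top command extends a run of what is pending after it to a run of what was
  -- pending before. The second alternative belongs to `drain`, which fires only on an empty stack,
  -- where nothing is left to prove.
  step-sound : ∀ ρ → need ρ ≤ registers → ∀ {w v : ℕ → Word} cs s →
    conf cs s ≐ᶜ (λ i → w i ++ preR ρ i) → v ≐ᶜ (λ i → w i ++ postR ρ i) →
    (∃ λ cs′ → ∃ λ s′ → v ≐ᶜ conf cs′ s′ × (Pending cs′ s′ → Pending cs s)) ⊎ Pending cs s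
  step-sound (exec o r) r<n {w} {v} cs s p q with cs′ , refl , w≡ ← stackW-pop (op o r) cs (p 0 (s≤s z≤n))
    with b , rel , w≡′ ← op-sound o (s r) {w (suc r)}
           (trans (p (suc r) (s≤s r<n)) (cong (w (suc r) ++_) (only-at r (before o)))) =
    inj₁ (cs′ , set s r b , v≡ , λ pend →
      set s r b , (subst (OpRel o (s r)) (sym (set-at s r b)) rel , set-off s r b) , pend)
    where
    v≡ : v ≐ᶜ conf cs′ (set s r b)
    v≡ zero 0< = trans (q 0 0<) (trans (++-identityʳ _) w≡)
    v≡ (suc x) x< with x ≟ r | p (suc x) x< | q (suc x) x<
    ... | yes refl | _ | q′ = trans q′ w≡′
    ... | no _ | p′ | q′ = trans q′ (sym p′)
  step-sound (unseq c d) _ {w} {v} cs s p q with cs′ , refl , w≡ ← stackW-pop (c ⨾ d) cs (p 0 (s≤s z≤n)) =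
    inj₁ (c ∷ d ∷ cs′ , s , v≡ , λ { (s₁ , c⇓ , s₂ , d⇓ , pend) → s₂ , (s₁ , c⇓ , d⇓) , pend })
    where
    v≡ : v ≐ᶜ conf (c ∷ d ∷ cs′) s
    v≡ zero 0< = trans (q 0 0<) (trans (sym (++-assoc (w 0) _ _))
      (cong (λ u → (u ∷ʳ letterOf d) ∷ʳ letterOf c) w≡))
    v≡ (suc x) x< = trans (q (suc x) x<) (sym (p (suc x) x<))
  step-sound (stop c) _ {w} {v} cs s p q with cs′ , refl , w≡ ← stackW-pop (star c) cs (p 0 (s≤s z≤n)) =
    inj₁ (cs′ , s , v≡ , λ pend → s , done (λ _ → refl) , pend)
    where
    v≡ : v ≐ᶜ conf cs′ s
    v≡ zero 0< = trans (q 0 0<) (trans (++-identityʳ _) w≡)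
    v≡ (suc x) x< = trans (q (suc x) x<) (sym (p (suc x) x<))
  step-sound (again c) _ {w} {v} cs s p q with cs′ , refl , w≡ ← stackW-pop (star c) cs (p 0 (s≤s z≤n)) =
    inj₁ (c ∷ star c ∷ cs′ , s , v≡ , λ { (s₁ , c⇓ , s₂ , d⇓ , pend) → s₂ , step c⇓ d⇓ , pend })
    where
    v≡ : v ≐ᶜ conf (c ∷ star c ∷ cs′) s
    v≡ zero 0< = trans (q 0 0<) (trans (sym (++-assoc (w 0) _ _))
      (cong (λ u → (u ∷ʳ letterOf (star c)) ∷ʳ letterOf c) w≡))
    v≡ (suc x) x< = trans (q (suc x) x<) (sym (p (suc x) x<))
  step-sound (drain r) _ cs s p q with refl ← stackW-empty cs (p 0 (s≤s z≤n)) = inj₂ tt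

  run-sound : ∀ {O v} → Run components pre post O v → ∀ cs s → v ≐ᶜ conf cs s → Pending cs s
  run-sound (done p) cs s v≡ with refl ← stackW-empty cs {[]} (trans (sym (v≡ 0 (s≤s z≤n))) (p 0 (s≤s z≤n))) = tt
  run-sound (step τ w v′ _ p q r) cs s v≡
    with step-sound (rule τ) (need-rule τ) cs s (λ i i< → trans (sym (v≡ i i<)) (p i i<)) q
  ... | inj₁ (cs′ , s′ , v′≡ , back) = back (run-sound r cs′ s′ v′≡)
  ... | inj₂ pend = pend

  MRun : (ℕ → Word) → Set
  MRun = Run components pre post Ok

  InAlphabet : Cmd → Set
  InAlphabet c = letterOf c ∈ alphabet

  Included : Cmd → Set
  Included c = ∀ {ρ} → ρ ∈ rulesOf c → ρ ∈ rulesOf c₀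

  included⇒inAlphabet : ∀ c → Included c → InAlphabet c
  included⇒inAlphabet (op o r) incl = there (there (∈-map⁺ _ (incl (here refl))))
  included⇒inAlphabet (c ⨾ d) incl = there (there (∈-map⁺ _ (incl (here refl))))
  included⇒inAlphabet (star c) incl = there (there (∈-map⁺ _ (incl (here refl))))

  conf-alphabet : ∀ {cs} s → All InAlphabet cs → ∀ i → All (_∈ alphabet) (conf cs s i)
  conf-alphabet s [] zero = here refl ∷ []
  conf-alphabet s (c∈ ∷ cs∈) zero = ++⁺ (conf-alphabet s cs∈ zero) (c∈ ∷ [])
  conf-alphabet s _ (suc x) = go (s x)
    where
    go : ∀ n → All (_∈ alphabet) (regW n)
    go zero = here refl ∷ []
    go (suc n) = ++⁺ (go n) (there (here refl) ∷ [])

  fire : ∀ {ρ} → ρ ∈ rules → ∀ w {v v′} → (∀ i → All (_∈ alphabet) (v′ i)) →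
    (∀ i → v i ≡ w i ++ preR ρ i) → (∀ i → v′ i ≡ w i ++ postR ρ i) → MRun v′ → MRun v
  fire {ρ} ρ∈ w alph p q r with τ , τ< , refl ← ∈⇒nth {d = stop c₀} ρ∈ =
    step τ w _ (τ< , alph) (λ i _ → p i) (λ i _ → q i) r

  update : (o : Op) (r : ℕ) {s s′ : State} {stk : Word} → ⟦ op o r ⟧ s s′ →
    ∃ λ (w : ℕ → Word) → w 0 ≡ stk ×
      (∀ x → regW (s x) ≡ w (suc x) ++ only r (before o) x) ×
      (∀ x → regW (s′ x) ≡ w (suc x) ++ only r (after o) x)
  update o r {s} {s′} {stk} (rel , off) with u , p , q ← op-complete o rel = w , refl , p′ , q′
    where
    w : ℕ → Word
    w zero = stk
    w (suc x) with x ≟ r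
    ... | yes _ = u
    ... | no _ = regW (s x)
    p′ : ∀ x → regW (s x) ≡ w (suc x) ++ only r (before o) x
    p′ x with x ≟ r
    ... | yes refl = p
    ... | no _ = sym (++-identityʳ _)
    q′ : ∀ x → regW (s′ x) ≡ w (suc x) ++ only r (after o) x
    q′ x with x ≟ r
    ... | yes refl = q
    ... | no x≢r = trans (cong regW (off x x≢r)) (sym (++-identityʳ _))

  cmd-complete : ∀ c {s s′ cs} → Included c → All InAlphabet cs → ⟦ c ⟧ s s′ →
    MRun (conf cs s′) → MRun (conf (c ∷ cs) s)
  cmd-complete (op o r) {s} {s′} {cs} incl cs∈ c⇓ run
    with w , w₀≡ , p , q ← update o r {stk = stackW cs} c⇓ =
    fire (∈-++⁺ˡ (incl (here refl))) w (conf-alphabet s′ cs∈)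
      (λ { zero → cong (_∷ʳ _) (sym w₀≡) ; (suc x) → p x })
      (λ { zero → trans (sym w₀≡) (sym (++-identityʳ _)) ; (suc x) → q x }) run
  cmd-complete (c ⨾ d) {s} {s′} {cs} incl cs∈ (s₁ , c⇓ , d⇓) run =
    fire (∈-++⁺ˡ (incl (here refl))) (conf cs s)
      (conf-alphabet s (included⇒inAlphabet c incl-c ∷ d∈ ∷ cs∈))
      (λ { zero → refl ; (suc x) → sym (++-identityʳ _) })
      (λ { zero → ++-assoc (stackW cs) _ _ ; (suc x) → sym (++-identityʳ _) })
      (cmd-complete c incl-c (d∈ ∷ cs∈) c⇓ (cmd-complete d incl-d cs∈ d⇓ run))
    where
    incl-c : Included c
    incl-c ρ∈ = incl (there (∈-++⁺ˡ ρ∈))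
    incl-d : Included d
    incl-d ρ∈ = incl (there (∈-++⁺ʳ (rulesOf c) ρ∈))
    d∈ = included⇒inAlphabet d incl-d
  cmd-complete (star c) {s} {s′} {cs} incl cs∈ (done eq) run =
    fire (∈-++⁺ˡ (incl (here refl))) (conf cs s) (conf-alphabet s′ cs∈)
      (λ { zero → refl ; (suc x) → sym (++-identityʳ _) })
      (λ { zero → sym (++-identityʳ _) ; (suc x) → trans (cong regW (eq x)) (sym (++-identityʳ _)) }) run
  cmd-complete (star c) {s} {s′} {cs} incl cs∈ (step c⇓ cs⇓) run =
    fire (∈-++⁺ˡ (incl (there (here refl)))) (conf cs s)
      (conf-alphabet s (included⇒inAlphabet c incl-c ∷ star∈ ∷ cs∈))
      (λ { zero → refl ; (suc x) → sym (++-identityʳ _) })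
      (λ { zero → ++-assoc (stackW cs) _ _ ; (suc x) → sym (++-identityʳ _) })
      (cmd-complete c incl-c (star∈ ∷ cs∈) c⇓ (cmd-complete (star c) incl cs∈ cs⇓ run))
    where
    incl-c : Included c
    incl-c ρ∈ = incl (there (there ρ∈))
    star∈ = included⇒inAlphabet (star c) incl

  conf-≗ : ∀ {cs s s′} → (∀ x → s′ x ≡ s x) → ∀ i → conf cs s′ i ≡ conf cs s i
  conf-≗ eq zero = refl
  conf-≗ eq (suc x) = cong regW (eq x)

  drain-register : ∀ {r} → r < registers → ∀ n {s} → s r ≡ n → MRun (conf [] (set s r 0)) → MRun (conf [] s)
  drain-register {r} r< zero {s} eq run =
    Run-resp _ _ _ _ (conf-≗ (Off-≗ (trans eq (sym (set-at s r 0))) (Off-sym (set-off s r 0)))) run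
  drain-register {r} r< (suc n) {s} eq run
    with w , w₀≡ , p , q ← update dec r {s} {set s r n} {[]}
           (trans eq (cong suc (sym (set-at s r n))) , set-off s r n) =
    fire (∈-++⁺ʳ (rulesOf c₀) (∈-map⁺ drain (∈-upTo⁺ r<))) w (conf-alphabet (set s r n) [])
      (λ { zero → cong (_∷ʳ 0) (sym w₀≡) ; (suc x) → p x })
      (λ { zero → cong (_∷ʳ 0) (sym w₀≡) ; (suc x) → q x })
      (drain-register r< n (set-at s r n) (Run-resp _ _ _ _ (conf-≗ same) run))
    where
    same : ∀ x → set (set s r n) r 0 x ≡ set s r 0 x
    same = Off-≗ (trans (set-at _ r 0) (sym (set-at s r 0)))
             (Off-trans (Off-sym (set-off s r 0)) (Off-trans (set-off s r n) (set-off _ r 0)))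

  drain-all : ∀ m → m ≤ registers → ∀ {s} → (∀ x → m ≤ x → x < registers → s x ≡ 0) → MRun (conf [] s)
  drain-all zero _ zeros = done λ { zero _ → refl ; (suc x) (s≤s x<) → cong regW (zeros x z≤n x<) }
  drain-all (suc m) m< {s} zeros = drain-register m< (s m) refl (drain-all m (<⇒≤ m<) zeros′)
    where
    zeros′ : ∀ x → m ≤ x → x < registers → set s m 0 x ≡ 0
    zeros′ x m≤x x< with x ≟ m
    ... | yes _ = refl
    ... | no x≢m = zeros x (≤∧≢⇒< m≤x (≢-sym x≢m)) x<

  machine-complete : ∀ {s s′} → ⟦ c₀ ⟧ s s′ → MRun (conf (c₀ ∷ []) s)
  machine-complete {s} {s′} c⇓ = cmd-complete c₀ (λ ρ∈ → ρ∈) [] c⇓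
    (drain-all registers ≤-refl {s′} λ x n≤x x<n → ⊥-elim (<⇒≱ x<n n≤x))

  machine-sound : ∀ {O s} → Run components pre post O (conf (c₀ ∷ []) s) → ∃ λ s′ → ⟦ c₀ ⟧ s s′
  machine-sound {s = s} run =
    let s′ , c⇓ , _ = run-sound run (c₀ ∷ []) s (λ _ _ → refl) in s′ , c⇓

-- The quantifier-free matrix

data Tree : Set where
  cst  : ℕ → ℕ → Tree
  app  : ℕ → Tree → Tree
  pair : Tree → Tree → Tree

-- The constants of the n copies are pairwise distinct, the other symbols are shared.
term : ℕ → Tree → Term
term j (cst a b) = fun (suc j) 2 (fun a 0 [] ∷ fun b 0 [] ∷ [])
term j (app a g) = fun a 1 (term j g ∷ [])
term j (pair g h) = fun 0 2 (term j g ∷ term j h ∷ [])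

-- `ε` ends words, tuples and lists of configurations, `ν` ends lists of steps, and `ι` stands for
-- the numeral of the input.
ε ν ι : Tree
ε = cst 0 0
ν = cst 0 1
ι = cst 0 2

leaf : ℕ → ℕ → Tree
leaf τ i = cst (suc τ) i

wordG : Word → Tree → Tree
wordG [] g = g
wordG (a ∷ w) g = app a (wordG w g)

wordG-++ : ∀ u w g → wordG (u ++ w) g ≡ wordG u (wordG w g)
wordG-++ [] w g = refl
wordG-++ (a ∷ u) w g = cong (app a) (wordG-++ u w g)

tupG : ℕ → (ℕ → Tree) → Tree
tupG zero f = ε
tupG (suc N) f = pair (f 0) (tupG N (f ∘ suc))

confG : ℕ → (ℕ → Word) → Tree
confG N v = tupG N (λ i → wordG (v i) ε)

numG : ℕ → Tree
numG zero = ε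
numG (suc x) = app 1 (numG x)

data Kind : Set where
  shape old new pure : Kind

kinds : List Kind
kinds = shape ∷ old ∷ new ∷ pure ∷ []

all-kinds : {Q : QF → Set} (f : Kind → QF) → (∀ κ → Q (f κ)) → All Q (map f kinds)
all-kinds f p = p shape ∷ p old ∷ p new ∷ p pure ∷ []

each-kind : {Q : QF → Set} (f : Kind → QF) → All Q (map f kinds) → ∀ κ → Q (f κ)
each-kind f (p ∷ _) shape = p
each-kind f (_ ∷ p ∷ _) old = p
each-kind f (_ ∷ _ ∷ p ∷ _) new = p
each-kind f (_ ∷ _ ∷ _ ∷ p ∷ _) pure = p

conj : List QF → QF
conj [] = ¬q ⊥q
conj (φ ∷ φs) = φ ∧q conj φs

module Encoding (N : ℕ) (pre post : ℕ → ℕ → Word) (R : ℕ) (alphabet : List ℕ) (init : ℕ → Word) where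

  start : ℕ → ℕ → Word
  start x (suc zero) = 0 ∷ replicate x 1
  start x i = init i

  -- Component 1 is the input register. Writing `ι` there keeps the copies independent of the input,
  -- which `head` supplies later as an equation for `ι`.
  startC : ℕ → Tree
  startC (suc zero) = app 0 ι
  startC i = wordG (init i) ε

  startG : Tree
  startG = tupG N startC

  finalG : Tree
  finalG = confG N (λ _ → 0 ∷ [])

  reading : (ℕ → ℕ → Word) → Tree → List (Tree × Tree)
  reading rd end = (ν , end) ∷ concat (applyUpTo (λ τ → applyUpTo (λ i → leaf τ i , wordG (rd τ i) ε) N) R)

  -- For `shape`, a leaf absorbs the letters above it, and `ν` absorbs a full tuple of leaves of one
  -- rule; so all components of a step must use the same rule. A run has one configuration more than
  -- it has steps: `old` lists all of them, whence `ν` becomes a list holding the final one, while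
  -- `new` lists all but the start.
  hyps : Kind → List (Tree × Tree)
  hyps shape = concat (applyUpTo (λ τ → (pair (tupG N (leaf τ)) ν , ν) ∷
                 concat (applyUpTo (λ i → map (λ a → app a (leaf τ i) , leaf τ i) alphabet) N)) R)
  hyps old = reading pre (pair finalG ε)
  hyps new = reading post ε
  hyps pure = (pair ε ε , ε) ∷ map (λ a → app a ε , ε) alphabet

  lhs : Kind → Term → Term → Term
  lhs shape L Y = L
  lhs old L Y = L
  lhs new L Y = L
  lhs pure L Y = Y

  rhs : Kind → ℕ → Term → Term → Term
  rhs shape j L Y = term j ν
  rhs old j L Y = fun 0 2 (term j startG ∷ Y ∷ [])
  rhs new j L Y = Y
  rhs pure j L Y = term j ε

  equation : ℕ → Tree × Tree → QF
  equation j (g , h) = term j g ≐ term j h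

  clause : ℕ → Term → Term → Kind → QF
  clause j L Y κ = conj (map (equation j) (hyps κ)) ⇒q (lhs κ L Y ≐ rhs κ j L Y)

  copy : ℕ → Term → Term → QF
  copy j L Y = conj (map (clause j L Y) kinds)

  Ok : ℕ → (ℕ → Word) → Set
  Ok τ v = τ < R × (∀ i → All (_∈ alphabet) (v i))

  tilesG confsG : ∀ {O v} → Run N pre post O v → Tree
  tilesG (done _) = ν
  tilesG (step τ w _ _ _ _ r) = pair (tupG N (λ i → wordG (w i) (leaf τ i))) (tilesG r)
  confsG (done _) = ε
  confsG (step _ _ v′ _ _ _ r) = pair (confG N v′) (confsG r)

  -- Only congruence of the evaluation is assumed, so the argument serves every structure and every
  -- copy.
  module Completeness {D : Set} (ev : Tree → D)
    (app-cong : ∀ a {g h} → ev g ≡ ev h → ev (app a g) ≡ ev (app a h))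
    (pair-cong : ∀ {g g′ h h′} → ev g ≡ ev g′ → ev h ≡ ev h′ → ev (pair g h) ≡ ev (pair g′ h′)) where

    Valid : Tree × Tree → Set
    Valid (g , h) = ev g ≡ ev h

    wordG-cong : ∀ w {g h} → ev g ≡ ev h → ev (wordG w g) ≡ ev (wordG w h)
    wordG-cong [] eq = eq
    wordG-cong (a ∷ w) eq = app-cong a (wordG-cong w eq)

    wordG-absorb : ∀ {w g} → All (λ a → ev (app a g) ≡ ev g) w → ev (wordG w g) ≡ ev g
    wordG-absorb [] = refl
    wordG-absorb {a ∷ w} (eq ∷ eqs) = trans (app-cong a (wordG-absorb eqs)) eq

    tupG-cong : ∀ n {f f′} → (∀ i → i < n → ev (f i) ≡ ev (f′ i)) → ev (tupG n f) ≡ ev (tupG n f′)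
    tupG-cong zero eqs = refl
    tupG-cong (suc n) eqs = pair-cong (eqs 0 (s≤s z≤n)) (tupG-cong n (λ i i<n → eqs (suc i) (s≤s i<n)))

    confG-cong : ∀ {v v′} → (∀ i → i < N → v i ≡ v′ i) → ev (confG N v) ≡ ev (confG N v′)
    confG-cong eqs = tupG-cong N (λ i i<N → cong (λ w → ev (wordG w ε)) (eqs i i<N))

    shape-complete : All Valid (hyps shape) → ∀ {v} (r : Run N pre post Ok v) → ev (tilesG r) ≡ ev ν
    shape-complete hs (done _) = refl
    shape-complete hs (step τ w v′ (τ<R , alph) _ q r) =
      trans (pair-cong tile≡ (shape-complete hs r)) (All.head hs′)
      where
      hs′ = applyUpTo⁻ _ R (concat⁻ {xss = applyUpTo _ R} hs) τ<R
      tile≡ : ev (tupG N (λ i → wordG (w i) (leaf τ i))) ≡ ev (tupG N (leaf τ))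
      tile≡ = tupG-cong N λ i i<N → wordG-absorb (All.map
        (λ a∈ → All.lookup (map⁻ (applyUpTo⁻ _ N (concat⁻ {xss = applyUpTo _ N} (All.tail hs′)) i<N)) a∈)
        (++⁻ˡ (w i) (subst (All (_∈ alphabet)) (q i i<N) (alph i))))

    reading-complete : ∀ {rd end} → All Valid (reading rd end) → ∀ {τ} → τ < R → ∀ (w : ℕ → Word) →
      ev (tupG N (λ i → wordG (w i) (leaf τ i))) ≡ ev (confG N (λ i → w i ++ rd τ i))
    reading-complete {rd} (_ ∷ hs) {τ} τ<R w = tupG-cong N λ i i<N →
      trans (wordG-cong (w i) (applyUpTo⁻ _ N (applyUpTo⁻ _ R (concat⁻ {xss = applyUpTo _ R} hs) τ<R) i<N))
            (cong ev (sym (wordG-++ (w i) (rd τ i) ε)))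

    old-complete : All Valid (hyps old) → ∀ {v} (r : Run N pre post Ok v) →
                   ev (tilesG r) ≡ ev (pair (confG N v) (confsG r))
    old-complete (h ∷ _) (done p) = trans h (pair-cong (sym (confG-cong p)) refl)
    old-complete hs (step τ w v′ (τ<R , _) p _ r) =
      pair-cong (trans (reading-complete hs τ<R w) (sym (confG-cong p))) (old-complete hs r)

    new-complete : All Valid (hyps new) → ∀ {v} (r : Run N pre post Ok v) → ev (tilesG r) ≡ ev (confsG r)
    new-complete (h ∷ _) (done _) = h
    new-complete hs (step τ w v′ (τ<R , _) _ q r) =
      pair-cong (trans (reading-complete hs τ<R w) (sym (confG-cong q))) (new-complete hs r)

    pure-complete : All Valid (hyps pure) → ∀ {v} (r : Run N pre post Ok v) → ev (confsG r) ≡ ev ε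
    pure-complete _ (done _) = refl
    pure-complete (h ∷ hs) (step τ w v′ (_ , alph) _ _ r) =
      trans (pair-cong (tuple N (λ i → alph i)) (pure-complete (h ∷ hs) r)) h
      where
      tuple : ∀ n {v} → (∀ i → All (_∈ alphabet) (v i)) → ev (confG n v) ≡ ev ε
      tuple zero _ = refl
      tuple (suc n) alph = trans
        (pair-cong (wordG-absorb (All.map (All.lookup (map⁻ hs)) (alph 0))) (tuple n (alph ∘ suc))) h

    numG≡ : ∀ x → numG x ≡ wordG (replicate x 1) ε
    numG≡ zero = refl
    numG≡ (suc x) = cong (app 1) (numG≡ x)

    startG-complete : ∀ {x} → ev ι ≡ ev (numG x) → ev startG ≡ ev (confG N (start x))
    startG-complete {x} eq = tupG-cong N λ
      { zero _ → refl
      ; (suc zero) _ → app-cong 0 (trans eq (cong ev (numG≡ x)))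
      ; (suc (suc i)) _ → refl }

-- Structures that read off a computation

-- `raw` is the value of a 0-ary symbol, which occurs in trees only as an index of `cst`. Keeping it
-- apart from `lf` lets `conI` recover the indices.
data Val : Set where
  raw : ℕ → Val
  lf  : ℕ → ℕ → Val
  lt  : ℕ → Val → Val
  pr  : Val → Val → Val

lf-injective : ∀ {a b c d} → lf a b ≡ lf c d → a ≡ c × b ≡ d
lf-injective refl = refl , refl

lt-injective : ∀ {a b u v} → lt a u ≡ lt b v → a ≡ b × u ≡ v
lt-injective refl = refl , refl

pr-injective : ∀ {a b c d} → pr a b ≡ pr c d → a ≡ c × b ≡ d
pr-injective refl = refl , refl

_≟ᵛ_ : DecidableEquality Val
raw a ≟ᵛ raw b = map′ (cong raw) (λ { refl → refl }) (a ≟ b)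
lf a b ≟ᵛ lf c d = map′ (λ { (refl , refl) → refl }) lf-injective (a ≟ c ×-dec b ≟ d)
lt a u ≟ᵛ lt b v = map′ (λ { (refl , refl) → refl }) lt-injective (a ≟ b ×-dec u ≟ᵛ v)
pr a b ≟ᵛ pr c d = map′ (λ { (refl , refl) → refl }) pr-injective (a ≟ᵛ c ×-dec b ≟ᵛ d)
raw _ ≟ᵛ lf _ _ = no λ ()
raw _ ≟ᵛ lt _ _ = no λ ()
raw _ ≟ᵛ pr _ _ = no λ ()
lf _ _ ≟ᵛ raw _ = no λ ()
lf _ _ ≟ᵛ lt _ _ = no λ ()
lf _ _ ≟ᵛ pr _ _ = no λ ()
lt _ _ ≟ᵛ raw _ = no λ ()
lt _ _ ≟ᵛ lf _ _ = no λ ()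
lt _ _ ≟ᵛ pr _ _ = no λ ()
pr _ _ ≟ᵛ raw _ = no λ ()
pr _ _ ≟ᵛ lf _ _ = no λ ()
pr _ _ ≟ᵛ lt _ _ = no λ ()

-- An interpretation of the symbols of one copy; nothing is a sink absorbing every operation,
-- and is the value of the constants of all other copies.
record Interpretation : Set where
  field
    con : ℕ → ℕ → Maybe Val
    apI : ℕ → Val → Val
    prI : Val → Val → Val

open Interpretation

conI : Interpretation → ℕ → ℕ → Maybe Val → Maybe Val → Maybe Val
conI I k j (just (raw a)) (just (raw b)) with j ≟ k
... | yes _ = con I a b
... | no  _ = nothing
conI I k j _ _ = nothing

fnI : Interpretation → ℕ → ℕ → (l : ℕ) → Vec (Maybe Val) l → Maybe Val
fnI I k f 0 [] = just (raw f)
fnI I k f 1 (u ∷ []) = mapM (apI I f) u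
fnI I k zero 2 (u ∷ v ∷ []) = zipWith (prI I) u v
fnI I k (suc j) 2 (u ∷ v ∷ []) = conI I k j u v
fnI I k f (suc (suc (suc _))) _ = nothing

module _ (I : Interpretation) (k : ℕ) (ρ υ : ℕ → Maybe Val) where
  mutual
    evI : Term → Maybe Val
    evI (var x) = ρ x
    evI (unk x) = υ x
    evI (fun f l ts) = fnI I k f l (evIs ts)

    evIs : ∀ {l} → Vec Term l → Vec (Maybe Val) l
    evIs [] = []
    evIs (t ∷ ts) = evI t ∷ evIs ts

evG : Interpretation → Tree → Maybe Val
evG I (cst a b) = con I a b
evG I (app a g) = mapM (apI I a) (evG I g)
evG I (pair g h) = zipWith (prI I) (evG I g) (evG I h)

evI-term-same : ∀ I k {ρ υ} g → evI I k ρ υ (term k g) ≡ evG I g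
evI-term-same I k (cst a b) with k ≟ k
... | yes _ = refl
... | no k≢k = ⊥-elim (k≢k refl)
evI-term-same I k (app a g) = cong (mapM _) (evI-term-same I k g)
evI-term-same I k (pair g h) = cong₂ (zipWith _) (evI-term-same I k g) (evI-term-same I k h)

evI-term-other : ∀ I k {ρ υ} j → j ≢ k → ∀ g → evI I k ρ υ (term j g) ≡ nothing
evI-term-other I k j j≢k (cst a b) with j ≟ k
... | yes j≡k = ⊥-elim (j≢k j≡k)
... | no _ = refl
evI-term-other I k j j≢k (app a g) = cong (mapM _) (evI-term-other I k j j≢k g)
evI-term-other I k {ρ} {υ} j j≢k (pair g h) =
  cong (λ u → zipWith (prI I) u (evI I k ρ υ (term j h))) (evI-term-other I k j j≢k g)

sink : ℕ → Maybe Val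
sink _ = nothing

-- A solution is an arbitrary term, whose syntax is awkward to analyse. Its value in `I` takes the
-- place of the analysis: `Inv` says what this value reveals about the values in `J` and `K`.
record Simulation (I J K : Interpretation) : Set₁ where
  field
    Inv     : Val → Maybe Val → Maybe Val → Set
    Inv-raw : ∀ {a u v} → Inv (raw a) u v → u ≡ just (raw a) × v ≡ just (raw a)
    raw-Inv : ∀ a → Inv (raw a) (just (raw a)) (just (raw a))
    con-Inv : ∀ a b {c} → con I a b ≡ just c → Inv c (con J a b) (con K a b)
    app-Inv : ∀ a c {u v} → Inv c u v → Inv (apI I a c) (mapM (apI J a) u) (mapM (apI K a) v)
    pair-Inv : ∀ c d {u v u′ v′} → Inv c u v → Inv d u′ v′ →
               Inv (prI I c d) (zipWith (prI J) u u′) (zipWith (prI K) v v′)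

module _ {I J K : Interpretation} (sim : Simulation I J K) (k : ℕ) where
  open Simulation sim

  -- Variables, unknowns, symbols of arity above 2 and constants of other copies evaluate to the
  -- sink, so a value `just c` excludes them.
  simulate : ∀ t {c} → evI I k sink sink t ≡ just c → Inv c (evI J k sink sink t) (evI K k sink sink t)
  simulate (fun f 0 []) refl = raw-Inv f
  simulate (fun f 1 (t ∷ [])) eq with evI I k sink sink t in eqt
  simulate (fun f 1 (t ∷ [])) refl | just c = app-Inv f c (simulate t eqt)
  simulate (fun zero 2 (t ∷ u ∷ [])) eq with evI I k sink sink t in eqt | evI I k sink sink u in equ
  simulate (fun zero 2 (t ∷ u ∷ [])) refl | just c | just d = pair-Inv c d (simulate t eqt) (simulate u equ)
  simulate (fun (suc j) 2 (t ∷ u ∷ [])) eq with evI I k sink sink t in eqt | evI I k sink sink u in equ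
  simulate (fun (suc j) 2 (t ∷ u ∷ [])) eq | just (raw a) | just (raw b)
    with tJ , tK ← Inv-raw (simulate t eqt) | uJ , uK ← Inv-raw (simulate u equ)
    rewrite tJ | tK | uJ | uK with j ≟ k
  ... | yes _ = con-Inv a b eq
  simulate (fun (suc j) 2 (t ∷ u ∷ [])) () | just (raw a) | just (raw b) | no _

wordV : Word → Val
wordV [] = lf 0 0
wordV (a ∷ w) = lt a (wordV w)

wordV-injective : ∀ u w → wordV u ≡ wordV w → u ≡ w
wordV-injective [] [] _ = refl
wordV-injective (a ∷ u) (b ∷ w) eq with refl , eq′ ← lt-injective eq = cong (a ∷_) (wordV-injective u w eq′)

tupV : ℕ → (ℕ → Val) → Val
tupV zero f = lf 0 0
tupV (suc N) f = pr (f 0) (tupV N (f ∘ suc))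

tupV-injective : ∀ N {f g} → tupV N f ≡ tupV N g → ∀ i → i < N → f i ≡ g i
tupV-injective (suc N) eq zero _ = proj₁ (pr-injective eq)
tupV-injective (suc N) eq (suc i) (s≤s i<N) = tupV-injective N (proj₂ (pr-injective eq)) i i<N

numV : ℕ → Val
numV x = wordV (replicate x 1)

-- Reads the only possible rule index off the first component, so that a single comparison decides
-- whether a value is a tile. This is where having at least one component matters.
tileOf : Val → ℕ
tileOf (pr (lf (suc τ) _) _) = τ
tileOf _ = 0

tileOf-tupV : ∀ {N} → 0 < N → ∀ τ → tileOf (tupV N (lf (suc τ))) ≡ τ
tileOf-tupV (s≤s _) τ = refl

-- Normal-form structures for the four clauses

module Soundness (N : ℕ) (pre post : ℕ → ℕ → Word) (R : ℕ) (alphabet : List ℕ) (init : ℕ → Word)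
                 (0<N : 0 < N) (x : ℕ) where
  open Encoding N pre post R alphabet init

  tileV : ℕ → Val
  tileV τ = tupV N (lf (suc τ))

  finalV : Val
  finalV = tupV N (λ _ → wordV (0 ∷ []))

  prS : Val → Val → Val
  prS a b with b ≟ᵛ lf 0 1 | a ≟ᵛ tileV (tileOf a)
  ... | yes _ | yes _ = lf 0 1
  ... | _     | _     = pr a b

  apS : ℕ → Val → Val
  apS a (lf (suc τ) i) = lf (suc τ) i
  apS a v = lt a v

  conS : ℕ → ℕ → Maybe Val
  conS 0 0 = just (lf 0 0)
  conS 0 1 = just (lf 0 1)
  conS 0 2 = just (numV x)
  conS 0 _ = nothing
  conS (suc τ) i = just (lf (suc τ) i)

  conR : (ℕ → ℕ → Word) → Val → ℕ → ℕ → Maybe Val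
  conR rd end 0 0 = just (lf 0 0)
  conR rd end 0 1 = just end
  conR rd end 0 2 = just (numV x)
  conR rd end 0 _ = nothing
  conR rd end (suc τ) i = just (wordV (rd τ i))

  -- Leaves and `ν` are sent to the sink, so no term containing them can reach the value of `ε`. The
  -- value of `ι` is forced by its numeral, which collapses to `ε`.
  conP : ℕ → ℕ → Maybe Val
  conP 0 0 = just (lf 0 0)
  conP 0 2 = just (lf 0 0)
  conP _ _ = nothing

  apP : ℕ → Val → Val
  apP a (lf 0 0) = lf 0 0
  apP a v = lt a v

  prP : Val → Val → Val
  prP (lf 0 0) (lf 0 0) = lf 0 0
  prP a b = pr a b

  int : Kind → Interpretation
  int shape = record { con = conS ; apI = apS ; prI = prS }
  int old   = record { con = conR pre (pr finalV (lf 0 0)) ; apI = lt ; prI = pr }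
  int new   = record { con = conR post (lf 0 0) ; apI = lt ; prI = pr }
  int pure  = record { con = conP ; apI = apP ; prI = prP }

  Valid : Interpretation → Tree × Tree → Set
  Valid I (g , h) = evG I g ≡ evG I h

  evG-wordR : ∀ {I} → apI I ≡ lt → con I 0 0 ≡ just (lf 0 0) → ∀ w → evG I (wordG w ε) ≡ just (wordV w)
  evG-wordR refl eq [] = eq
  evG-wordR refl eq (a ∷ w) = cong (mapM (lt a)) (evG-wordR refl eq w)

  evG-tupR : ∀ {I} → prI I ≡ pr → con I 0 0 ≡ just (lf 0 0) → ∀ n {f g} →
             (∀ i → evG I (f i) ≡ just (g i)) → evG I (tupG n f) ≡ just (tupV n g)
  evG-tupR refl eq zero eqs = eq
  evG-tupR refl eq (suc n) eqs = cong₂ (zipWith pr) (eqs 0) (evG-tupR refl eq n (eqs ∘ suc))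

  ι-valid : ∀ κ → evG (int κ) ι ≡ evG (int κ) (numG x)
  ι-valid shape = sym (go x)
    where
    go : ∀ y → evG (int shape) (numG y) ≡ just (numV y)
    go zero = refl
    go (suc zero) = refl
    go (suc (suc y)) rewrite go (suc y) = refl
  ι-valid old = sym (go x)
    where
    go : ∀ y → evG (int old) (numG y) ≡ just (numV y)
    go zero = refl
    go (suc y) = cong (mapM (lt 1)) (go y)
  ι-valid new = sym (go x)
    where
    go : ∀ y → evG (int new) (numG y) ≡ just (numV y)
    go zero = refl
    go (suc y) = cong (mapM (lt 1)) (go y)
  ι-valid pure = sym (go x)
    where
    go : ∀ y → evG (int pure) (numG y) ≡ just (lf 0 0)
    go zero = refl
    go (suc y) = cong (mapM (apP 1)) (go y)

  -- The value of a tuple is `lf 0 0` or a pair, never the `lf 0 1` that triggers absorption.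
  prS-tuple : ∀ a n f → prS a (tupV n f) ≡ pr a (tupV n f)
  prS-tuple a zero f with a ≟ᵛ tileV (tileOf a)
  ... | yes _ = refl
  ... | no _ = refl
  prS-tuple a (suc n) f with a ≟ᵛ tileV (tileOf a)
  ... | yes _ = refl
  ... | no _ = refl

  evG-tupS : ∀ τ n (f : ℕ → ℕ) →
             evG (int shape) (tupG n (λ i → leaf τ (f i))) ≡ just (tupV n (λ i → lf (suc τ) (f i)))
  evG-tupS τ zero f = refl
  evG-tupS τ (suc n) f rewrite evG-tupS τ n (f ∘ suc) = cong just (prS-tuple _ n _)

  prS-tile : ∀ τ → prS (tileV τ) (lf 0 1) ≡ lf 0 1
  prS-tile τ with tileV τ ≟ᵛ tileV (tileOf (tileV τ))
  ... | yes _ = refl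
  ... | no ≢ = ⊥-elim (≢ (cong tileV (sym (tileOf-tupV 0<N τ))))

  reading-valid : ∀ rd end endV I → con I ≡ conR rd endV → apI I ≡ lt → evG I end ≡ just endV →
                  All (Valid I) (reading rd end)
  reading-valid rd end endV I refl eq-ap eq-end =
    sym eq-end ∷ concat⁺ (applyUpTo⁺₂ _ R λ τ → applyUpTo⁺₂ _ N λ i → sym (evG-wordR eq-ap refl (rd τ i)))

  hyps-valid : ∀ κ → All (Valid (int κ)) (hyps κ)
  hyps-valid shape = concat⁺ (applyUpTo⁺₂ _ R λ τ → tile τ ∷
    concat⁺ (applyUpTo⁺₂ _ N λ i → map⁺ (universal (λ _ → refl) alphabet)))
    where
    tile : ∀ τ → evG (int shape) (pair (tupG N (leaf τ)) ν) ≡ just (lf 0 1)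
    tile τ rewrite evG-tupS τ N (λ i → i) = cong just (prS-tile τ)
  hyps-valid old = reading-valid pre _ _ _ refl refl
    (cong₂ (zipWith pr) (evG-tupR {int old} refl refl N (λ _ → refl)) refl)
  hyps-valid new = reading-valid post _ _ _ refl refl refl
  hyps-valid pure = refl ∷ map⁺ (universal (λ _ → refl) alphabet)

  Tiles : Set
  Tiles = List (ℕ × (ℕ → Word))

  rowV : (ℕ → ℕ → Word) → ℕ → (ℕ → Word) → ℕ → Val
  rowV rd τ w i = wordV (w i ++ rd τ i)

  listV : (ℕ → ℕ → Word) → Val → Tiles → Val
  listV rd end [] = end
  listV rd end ((τ , w) ∷ ts) = pr (tupV N (rowV rd τ w)) (listV rd end ts)

  endV : Val
  endV = pr finalV (lf 0 0)

  -- A value keeps what its later use may require: a leaf the letters it has absorbed, `lf 0 1` the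
  -- steps it has absorbed, a `pr` the invariants of its parts, since it may still become a tile. An
  -- `lt` can no longer occur in a tile and promises nothing.
  InvS : Val → Maybe Val → Maybe Val → Set
  InvS (raw a) u v = u ≡ just (raw a) × v ≡ just (raw a)
  InvS (lf 0 0) u v = u ≡ just (lf 0 0) × v ≡ just (lf 0 0)
  InvS (lf 0 1) u v = ∃ λ ts → u ≡ just (listV pre endV ts) × v ≡ just (listV post (lf 0 0) ts)
  InvS (lf 0 (suc (suc _))) u v = ⊤
  InvS (lf (suc τ) i) u v = ∃ λ w → u ≡ just (wordV (w ++ pre τ i)) × v ≡ just (wordV (w ++ post τ i))
  InvS (lt _ _) u v = ⊤
  InvS (pr a b) u v = ∃ λ u₁ → ∃ λ u₂ → ∃ λ v₁ → ∃ λ v₂ →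
    u ≡ zipWith pr u₁ u₂ × v ≡ zipWith pr v₁ v₂ × InvS a u₁ v₁ × InvS b u₂ v₂

  InvS-tuple : ∀ τ n (f : ℕ → ℕ) {u v} → InvS (tupV n (λ i → lf (suc τ) (f i))) u v →
    ∃ λ (w : ℕ → Word) → u ≡ just (tupV n (λ i → wordV (w i ++ pre τ (f i)))) ×
                         v ≡ just (tupV n (λ i → wordV (w i ++ post τ (f i))))
  InvS-tuple τ zero f (p , q) = (λ _ → []) , p , q
  InvS-tuple τ (suc n) f (_ , _ , _ , _ , refl , refl , (w₀ , refl , refl) , rest)
    with w , refl , refl ← InvS-tuple τ n (f ∘ suc) rest = (λ { zero → w₀ ; (suc i) → w i }) , refl , refl

  simS : Simulation (int shape) (int old) (int new)
  simS = record
    { Inv = InvS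
    ; Inv-raw = λ p → p
    ; raw-Inv = λ _ → refl , refl
    ; con-Inv = con-Inv
    ; app-Inv = app-Inv
    ; pair-Inv = pair-Inv
    }
    where
    num-Inv : ∀ y → InvS (numV y) (just (numV y)) (just (numV y))
    num-Inv zero = refl , refl
    num-Inv (suc y) = tt
    con-Inv : ∀ a b {c} → conS a b ≡ just c → InvS c (con (int old) a b) (con (int new) a b)
    con-Inv 0 0 refl = refl , refl
    con-Inv 0 1 refl = [] , refl , refl
    con-Inv 0 2 refl = num-Inv x
    con-Inv (suc τ) i refl = [] , refl , refl
    app-Inv : ∀ a c {u v} → InvS c u v → InvS (apS a c) (mapM (lt a) u) (mapM (lt a) v)
    app-Inv a (raw _) _ = tt
    app-Inv a (lf zero _) _ = tt
    app-Inv a (lf (suc τ) i) (w , refl , refl) = a ∷ w , refl , refl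
    app-Inv a (lt _ _) _ = tt
    app-Inv a (pr _ _) _ = tt
    pair-Inv : ∀ c d {u v u′ v′} → InvS c u v → InvS d u′ v′ →
               InvS (prS c d) (zipWith pr u u′) (zipWith pr v v′)
    pair-Inv c d p q with d ≟ᵛ lf 0 1 | c ≟ᵛ tileV (tileOf c)
    -- The absorbing case: the words recorded in the tile become one more step in front of the list.
    pair-Inv c d p (ts , refl , refl) | yes refl | yes c≡
      with w , refl , refl ← InvS-tuple (tileOf c) N (λ i → i) (subst (λ c → InvS c _ _) c≡ p) =
      (tileOf c , w) ∷ ts , refl , refl
    ... | yes _ | no _ = _ , _ , _ , _ , refl , refl , p , q
    ... | no _ | yes _ = _ , _ , _ , _ , refl , refl , p , q
    ... | no _ | no _ = _ , _ , _ , _ , refl , refl , p , q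

  InvP : Val → Maybe Val → Maybe Val → Set
  InvP (raw a) u v = u ≡ just (raw a) × v ≡ just (raw a)
  InvP _ u v = u ≡ v

  InvP⇒≡ : ∀ c {u v} → InvP c u v → u ≡ v
  InvP⇒≡ (raw _) (refl , refl) = refl
  InvP⇒≡ (lf _ _) eq = eq
  InvP⇒≡ (lt _ _) eq = eq
  InvP⇒≡ (pr _ _) eq = eq

  -- `old` and `new` differ only on leaves and `ν`, which `pure` sends to the sink. A pure `Y` thus
  -- has the same value under both readings, and the two equations speak of one list.
  simP : Simulation (int pure) (int old) (int new)
  simP = record
    { Inv = InvP
    ; Inv-raw = λ p → p
    ; raw-Inv = λ _ → refl , refl
    ; con-Inv = con-Inv
    ; app-Inv = app-Inv
    ; pair-Inv = pair-Inv
    }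
    where
    con-Inv : ∀ a b {c} → conP a b ≡ just c → InvP c (con (int old) a b) (con (int new) a b)
    con-Inv 0 0 refl = refl
    con-Inv 0 2 refl = refl
    app-Inv : ∀ a c {u v} → InvP c u v → InvP (apP a c) (mapM (lt a) u) (mapM (lt a) v)
    app-Inv a c {u} {v} p = go c (cong (mapM (lt a)) (InvP⇒≡ c p))
      where
      go : ∀ c {u v} → u ≡ v → InvP (apP a c) u v
      go (raw _) eq = eq
      go (lf 0 0) eq = eq
      go (lf 0 (suc _)) eq = eq
      go (lf (suc _) _) eq = eq
      go (lt _ _) eq = eq
      go (pr _ _) eq = eq
    pair-Inv : ∀ c d {u v u′ v′} → InvP c u v → InvP d u′ v′ →
               InvP (prP c d) (zipWith pr u u′) (zipWith pr v v′)
    pair-Inv c d p q = go c d (cong₂ (zipWith pr) (InvP⇒≡ c p) (InvP⇒≡ d q))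
      where
      go : ∀ c d {u v} → u ≡ v → InvP (prP c d) u v
      go (lf 0 0) (lf 0 0) eq = eq
      go (raw _) _ eq = eq
      go (lt _ _) _ eq = eq
      go (pr _ _) _ eq = eq
      go (lf (suc _) _) _ eq = eq
      go (lf 0 (suc _)) _ eq = eq
      go (lf 0 0) (raw _) eq = eq
      go (lf 0 0) (lt _ _) eq = eq
      go (lf 0 0) (pr _ _) eq = eq
      go (lf 0 0) (lf (suc _) _) eq = eq
      go (lf 0 0) (lf 0 (suc _)) eq = eq

  NoCheck : ℕ → (ℕ → Word) → Set
  NoCheck _ _ = ⊤

  -- The list of old configurations is the list of new ones with v put in front.
  shifted⇒run : ∀ ts v → listV pre endV ts ≡ pr (tupV N (wordV ∘ v)) (listV post (lf 0 0) ts) →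
                Run N pre post NoCheck v
  shifted⇒run [] v eq = done λ i i<N →
    sym (wordV-injective _ _ (tupV-injective N (proj₁ (pr-injective eq)) i i<N))
  shifted⇒run ((τ , w) ∷ ts) v eq with eq₁ , eq₂ ← pr-injective eq =
    step τ w (λ i → w i ++ post τ i) tt
      (λ i i<N → sym (wordV-injective _ _ (tupV-injective N eq₁ i i<N)))
      (λ _ _ → refl) (shifted⇒run ts _ eq₂)

  Goal : Kind → Maybe Val → Maybe Val → Set
  Goal shape a b = a ≡ just (lf 0 1)
  Goal old a b = a ≡ zipWith pr (evG (int old) startG) b
  Goal new a b = a ≡ b
  Goal pure a b = b ≡ just (lf 0 0)

  Goal? : ∀ κ a b → Dec (Goal κ a b)
  Goal? shape a b = Maybe-≡-dec _≟ᵛ_ _ _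
  Goal? old a b = Maybe-≡-dec _≟ᵛ_ _ _
  Goal? new a b = Maybe-≡-dec _≟ᵛ_ _ _
  Goal? pure a b = Maybe-≡-dec _≟ᵛ_ _ _

  evG-startG : evG (int old) startG ≡ just (tupV N (wordV ∘ start x))
  evG-startG = evG-tupR {int old} refl refl N λ
    { zero → evG-wordR {int old} refl refl (init 0)
    ; (suc zero) → refl
    ; (suc (suc i)) → evG-wordR {int old} refl refl (init (suc (suc i))) }

  goals⇒run : ∀ k L Y → (∀ κ → Goal κ (evI (int κ) k sink sink L) (evI (int κ) k sink sink Y)) →
              Run N pre post NoCheck (start x)
  goals⇒run k L Y goal with ts , L-old , L-new ← simulate simS k L (goal shape) =
    shifted⇒run ts (start x) (just-injective (begin
      just (listV pre endV ts)                                        ≡⟨ L-old ⟨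
      evI (int old) k sink sink L                                     ≡⟨ goal old ⟩
      zipWith pr (evG (int old) startG) (evI (int old) k sink sink Y) ≡⟨ cong₂ (zipWith pr) evG-startG Y≡ ⟩
      just (pr (tupV N (wordV ∘ start x)) (listV post (lf 0 0) ts))   ∎))
    where
    open ≡-Reasoning
    Y≡ : evI (int old) k sink sink Y ≡ just (listV post (lf 0 0) ts)
    Y≡ = trans (simulate simP k Y (goal pure)) (trans (sym (goal new)) L-new)

-- Skeletons and products of structures

∧-intro : ∀ {a b} → a ≡ true → b ≡ true → a ∧ b ≡ true
∧-intro refl refl = refl

∧-elim : ∀ a {b} → a ∧ b ≡ true → a ≡ true × b ≡ true
∧-elim true eq = refl , eq

∨-introˡ : ∀ {a b} → a ≡ true → a ∨ b ≡ true
∨-introˡ refl = refl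

∨-introʳ : ∀ a {b} → b ≡ true → a ∨ b ≡ true
∨-introʳ true _ = refl
∨-introʳ false eq = eq

∨-elim : ∀ a {b} → a ∨ b ≡ true → a ≡ true ⊎ b ≡ true
∨-elim true _ = inj₁ refl
∨-elim false eq = inj₂ eq

⇒-intro : ∀ a {b} → (a ≡ true → b ≡ true) → not a ∨ b ≡ true
⇒-intro true f = f refl
⇒-intro false f = refl

⇒-elim : ∀ {a b} → not a ∨ b ≡ true → a ≡ true → b ≡ true
⇒-elim eq refl = eq

does-true : ∀ {A : Set} (A? : Dec A) → does A? ≡ true → A
does-true (yes a) _ = a

module _ (St : Structure) (ρ υ : ℕ → Structure.D St) where

  mutual
    evalT-subst : ∀ s σ t →
      evalT St ρ υ (substT s σ t) ≡ evalT St (evalT St ρ υ ∘ s) (evalT St ρ υ ∘ σ) t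
    evalT-subst s σ (var _) = refl
    evalT-subst s σ (unk _) = refl
    evalT-subst s σ (fun f k ts) = cong (Structure.fn St f k) (evalTs-subst s σ ts)

    evalTs-subst : ∀ s σ {k} (ts : Vec Term k) →
      evalTs St ρ υ (substTs s σ ts) ≡ evalTs St (evalT St ρ υ ∘ s) (evalT St ρ υ ∘ σ) ts
    evalTs-subst s σ [] = refl
    evalTs-subst s σ (t ∷ ts) = cong₂ _∷_ (evalT-subst s σ t) (evalTs-subst s σ ts)

  evalQ-subst : ∀ s σ φ →
    evalQ St ρ υ (substQ s σ φ) ≡ evalQ St (evalT St ρ υ ∘ s) (evalT St ρ υ ∘ σ) φ
  evalQ-subst s σ (atom p k ts) = cong (Structure.pr St p k) (evalTs-subst s σ ts)
  evalQ-subst s σ (t ≐ u) =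
    cong₂ (λ a b → does (Structure._≟D_ St a b)) (evalT-subst s σ t) (evalT-subst s σ u)
  evalQ-subst s σ ⊥q = refl
  evalQ-subst s σ (¬q a) = cong not (evalQ-subst s σ a)
  evalQ-subst s σ (a ∧q b) = cong₂ _∧_ (evalQ-subst s σ a) (evalQ-subst s σ b)
  evalQ-subst s σ (a ∨q b) = cong₂ _∨_ (evalQ-subst s σ a) (evalQ-subst s σ b)
  evalQ-subst s σ (a ⇒q b) = cong₂ (λ a b → not a ∨ b) (evalQ-subst s σ a) (evalQ-subst s σ b)

  Holds : QF → Set
  Holds φ = evalQ St ρ υ φ ≡ true

  conj-intro : ∀ {φs} → All Holds φs → Holds (conj φs)
  conj-intro [] = refl
  conj-intro (p ∷ ps) = ∧-intro p (conj-intro ps)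

  conj-elim : ∀ φs → Holds (conj φs) → All Holds φs
  conj-elim [] _ = []
  conj-elim (φ ∷ φs) p = let q , qs = ∧-elim (evalQ St ρ υ φ) p in q ∷ conj-elim φs qs

  ≐-intro : ∀ {s t} → evalT St ρ υ s ≡ evalT St ρ υ t → Holds (s ≐ t)
  ≐-intro = dec-true (Structure._≟D_ St _ _)

  ≐-elim : ∀ s t → Holds (s ≐ t) → evalT St ρ υ s ≡ evalT St ρ υ t
  ≐-elim s t = does-true (Structure._≟D_ St _ _)

  ⋁-elim : ∀ σ n (f : Fin n → QF) → Holds (substUnk σ (⋁ n f)) → ∃ λ i → Holds (substUnk σ (f i))
  ⋁-elim σ (suc zero) f p = fzero , p
  ⋁-elim σ (suc n@(suc _)) f p =
    [ (λ q → fzero , q) , (λ q → let i , q′ = ⋁-elim σ n (λ i → f (fsuc i)) q in fsuc i , q′) ]′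
      (∨-elim (evalQ St ρ υ (substUnk σ (f fzero))) p)

  ⋁-intro : ∀ σ n (f : Fin n → QF) i → Holds (substUnk σ (f i)) → Holds (substUnk σ (⋁ n f))
  ⋁-intro σ (suc zero) f fzero p = p
  ⋁-intro σ (suc (suc n)) f fzero p = ∨-introˡ p
  ⋁-intro σ (suc n@(suc _)) f (fsuc i) p =
    ∨-introʳ (evalQ St ρ υ (substUnk σ (f fzero))) (⋁-intro σ n (λ i → f (fsuc i)) i p)

evalT-term : ∀ St {ρ υ ρ′ υ′} j g → evalT St ρ υ (term j g) ≡ evalT St ρ′ υ′ (term j g)
evalT-term St j (cst a b) = refl
evalT-term St j (app a g) = cong (λ d → Structure.fn St a 1 (d ∷ [])) (evalT-term St j g)
evalT-term St j (pair g h) =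
  cong₂ (λ d e → Structure.fn St 0 2 (d ∷ e ∷ [])) (evalT-term St j g) (evalT-term St j h)

-- Gives access to the substitution that `inst` hides in its local definitions; unification finds
-- it.
instantiation : ∀ m u φ → ∃ λ s → inst m u φ ≡ substQ s unk φ
instantiation m u φ = _ , refl

-- The helper inside inst ignores the outer arguments it is lifted over, which is why the
-- recursive call has the required type on the nose.
instantiation-unk : ∀ m u φ {i} (i<m : i < m) → proj₁ (instantiation m u φ) i ≡ unk (u (fromℕ< i<m))
instantiation-unk (suc m) u φ {zero} (s≤s z≤n) = refl
instantiation-unk (suc m) u φ {suc i} (s≤s i<m) = instantiation-unk m (u ∘ fsuc) φ i<m

vec-ext : ∀ {A : Set} {n} {u v : Vec A n} → (∀ i → lookup u i ≡ lookup v i) → u ≡ v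
vec-ext {u = u} {v} eq = trans (sym (tabulate∘lookup u)) (trans (tabulate-cong eq) (tabulate∘lookup v))

module Product {n : ℕ} (I : Fin n → Interpretation) where

  product : Structure
  product = record
    { D = Vec (Maybe Val) n
    ; _≟D_ = Vec-≡-dec (Maybe-≡-dec _≟ᵛ_)
    ; fn = λ f k ds → tabulate λ i → fnI (I i) (toℕ i) f k (mapᵛ (λ d → lookup d i) ds)
    ; pr = λ _ _ _ → false
    }

  module _ {ρ υ : ℕ → Vec (Maybe Val) n} (i : Fin n) {ρᵢ υᵢ : ℕ → Maybe Val}
           (eqρ : ∀ y → lookup (ρ y) i ≡ ρᵢ y) (eqυ : ∀ y → lookup (υ y) i ≡ υᵢ y) where
    mutual
      lookup-evalT : ∀ t → lookup (evalT product ρ υ t) i ≡ evI (I i) (toℕ i) ρᵢ υᵢ t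
      lookup-evalT (var y) = eqρ y
      lookup-evalT (unk y) = eqυ y
      lookup-evalT (fun f k ts) =
        trans (lookup∘tabulate _ i) (cong (fnI (I i) (toℕ i) f k) (lookup-evalTs ts))

      lookup-evalTs : ∀ {k} (ts : Vec Term k) →
        mapᵛ (λ d → lookup d i) (evalTs product ρ υ ts) ≡ evIs (I i) (toℕ i) ρᵢ υᵢ ts
      lookup-evalTs [] = refl
      lookup-evalTs (t ∷ ts) = cong₂ _∷_ (lookup-evalT t) (lookup-evalTs ts)

  -- The components of the other copies send both sides to the sink.
  equation-holds : ∀ ρ υ j g h → (∀ i → toℕ i ≡ j → evG (I i) g ≡ evG (I i) h) →
                   evalT product ρ υ (term j g) ≡ evalT product ρ υ (term j h)
  equation-holds ρ υ j g h eq = vec-ext λ i →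
    trans (lookup-evalT i (λ _ → refl) (λ _ → refl) (term j g))
      (trans (component i) (sym (lookup-evalT i (λ _ → refl) (λ _ → refl) (term j h))))
    where
    component : ∀ i → evI (I i) (toℕ i) (λ y → lookup (ρ y) i) (λ y → lookup (υ y) i) (term j g) ≡
                      evI (I i) (toℕ i) (λ y → lookup (ρ y) i) (λ y → lookup (υ y) i) (term j h)
    component i with toℕ i ≟ j
    ... | yes refl = trans (evI-term-same (I i) (toℕ i) g)
                       (trans (eq i refl) (sym (evI-term-same (I i) (toℕ i) h)))
    ... | no ≢ = trans (evI-term-other (I i) (toℕ i) j (≢-sym ≢) g)
                   (sym (evI-term-other (I i) (toℕ i) j (≢-sym ≢) h))

-- The drinker principle for four clauses: a violated clause is chosen if there is one, so the truth
-- of the chosen one entails all. The choice for each disjunct precedes knowing which disjunct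
-- holds.
failing : (Q : Kind → Set) → (∀ κ → Dec (Q κ)) → ∃ λ κ → Q κ → ∀ κ′ → Q κ′
failing Q Q? with Q? shape | Q? old | Q? new | Q? pure
... | no f | _ | _ | _ = shape , λ q → ⊥-elim (f q)
... | _ | no f | _ | _ = old , λ q → ⊥-elim (f q)
... | _ | _ | no f | _ = new , λ q → ⊥-elim (f q)
... | _ | _ | _ | no f = pure , λ q → ⊥-elim (f q)
... | yes a | yes b | yes c | yes d = shape , λ _ → λ { shape → a ; old → b ; new → c ; pure → d }

-- The sentence for an input and its two directions

head : ℕ → ℕ → QF
head n x = conj (applyUpTo (λ j → term j ι ≐ term j (numG x)) n)

noUnkT-term : ∀ j g → noUnkT (term j g) ≡ true
noUnkT-term j (cst a b) = refl
noUnkT-term j (app a g) = ∧-intro (noUnkT-term j g) refl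
noUnkT-term j (pair g h) = ∧-intro (noUnkT-term j g) (∧-intro (noUnkT-term j h) refl)

noVarT-term : ∀ j g → noVarT (term j g) ≡ true
noVarT-term j (cst a b) = refl
noVarT-term j (app a g) = ∧-intro (noVarT-term j g) refl
noVarT-term j (pair g h) = ∧-intro (noVarT-term j g) (∧-intro (noVarT-term j h) refl)

varsBelowT-term : ∀ m j g → varsBelowT m (term j g) ≡ true
varsBelowT-term m j (cst a b) = refl
varsBelowT-term m j (app a g) = ∧-intro (varsBelowT-term m j g) refl
varsBelowT-term m j (pair g h) = ∧-intro (varsBelowT-term m j g) (∧-intro (varsBelowT-term m j h) refl)

noUnkQ-conj : ∀ {φs} → All (λ φ → noUnkQ φ ≡ true) φs → noUnkQ (conj φs) ≡ true
noUnkQ-conj [] = refl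
noUnkQ-conj (p ∷ ps) = ∧-intro p (noUnkQ-conj ps)

varsBelowQ-conj : ∀ m {φs} → All (λ φ → varsBelowQ m φ ≡ true) φs → varsBelowQ m (conj φs) ≡ true
varsBelowQ-conj m [] = refl
varsBelowQ-conj m (p ∷ ps) = ∧-intro p (varsBelowQ-conj m ps)

varsBelow-var : ∀ {i m} → i < m → varsBelowT m (var i) ≡ true
varsBelow-var i<m = Equivalence.to T-≡ (<⇒<ᵇ i<m)

module Skeletons (N : ℕ) (pre post : ℕ → ℕ → Word) (R : ℕ) (alphabet : List ℕ) (init : ℕ → Word)
                 (0<N : 0 < N) (n : ℕ) where
  open Encoding N pre post R alphabet init

  rest : QF
  rest = conj (applyUpTo (λ j → copy j (var j) (var (n + j))) n)

  body : ℕ → QF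
  body x = head n x ⇒q rest

  sentence : ℕ → Formula
  sentence x = exs (n + n) (embed (body x))

  module _ (x : ℕ) where
    open Soundness N pre post R alphabet init 0<N x
      using (int; Goal; Goal?; hyps-valid; ι-valid; goals⇒run; NoCheck)

    goal-holds : ∀ κ k {ρ υ} L Y → evI (int κ) k ρ υ (lhs κ L Y) ≡ evI (int κ) k ρ υ (rhs κ k L Y) →
                 Goal κ (evI (int κ) k ρ υ L) (evI (int κ) k ρ υ Y)
    goal-holds shape k {ρ} {υ} L Y eq = trans eq (evI-term-same (int shape) k {ρ} {υ} ν)
    goal-holds old k {ρ} {υ} L Y eq =
      trans eq (cong (λ u → zipWith Val.pr u (evI (int old) k ρ υ Y)) (evI-term-same (int old) k startG))
    goal-holds new k L Y eq = eq
    goal-holds pure k {ρ} {υ} L Y eq = trans eq (evI-term-same (int pure) k {ρ} {υ} ε)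

    module Refutation (κ : Fin n → Kind) (σ : ℕ → Term) (s : Fin n → ℕ → Term) where
      open Product (λ i → int (κ i))

      -- Every disjunct contains all copies, but disjunct `i` is examined on copy `i` alone, the one
      -- whose constants component `i` does not send to the sink.
      L Y : Fin n → Term
      L i = substT var σ (s i (toℕ i))
      Y i = substT var σ (s i (n + toℕ i))

      ρ₀ υ₁ : ℕ → Vec (Maybe Val) n
      ρ₀ _ = replicateᵛ n nothing
      υ₁ y = evalT product ρ₀ ρ₀ (σ y)

      module _ (i : Fin n) where
        ρ₁ : ℕ → Vec (Maybe Val) n
        ρ₁ y = evalT product ρ₀ υ₁ (s i y)

        ρᵢ : ℕ → Maybe Val
        ρᵢ y = evI (int (κ i)) (toℕ i) sink sink (substT var σ (s i y))

        head-true : Holds product ρ₁ υ₁ (head n x)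
        head-true = conj-intro product ρ₁ υ₁ (applyUpTo⁺₂ _ n λ j →
          ≐-intro product ρ₁ υ₁ {term j ι} {term j (numG x)}
            (equation-holds ρ₁ υ₁ j ι (numG x) λ i′ _ → ι-valid (κ i′)))

        hyps-true : Holds product ρ₁ υ₁ (conj (map (equation (toℕ i)) (hyps (κ i))))
        hyps-true = conj-intro product ρ₁ υ₁ (map⁺ (All.map (λ {(g , h)} eq →
          ≐-intro product ρ₁ υ₁ {term (toℕ i) g} {term (toℕ i) h}
            (equation-holds ρ₁ υ₁ (toℕ i) g h λ i′ i′≡ →
              subst (λ i → evG (int (κ i)) g ≡ evG (int (κ i)) h) (sym (toℕ-injective i′≡)) eq))
          (hyps-valid (κ i))))

        value : ∀ y → lookup (ρ₁ y) i ≡ ρᵢ y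
        value y = trans (cong (λ d → lookup d i) (sym (evalT-subst product ρ₀ ρ₀ var σ (s i y))))
          (lookup-evalT i (λ _ → lookup-replicate i nothing) (λ _ → lookup-replicate i nothing)
            (substT var σ (s i y)))

        clause-true : Holds product ρ₁ υ₁ (body x) →
          ∀ κ → Holds product ρ₁ υ₁ (clause (toℕ i) (var (toℕ i)) (var (n + toℕ i)) κ)
        clause-true body-true = each-kind (clause (toℕ i) (var (toℕ i)) (var (n + toℕ i)))
          (conj-elim product ρ₁ υ₁ (map (clause (toℕ i) (var (toℕ i)) (var (n + toℕ i))) kinds)
            (applyUpTo⁻ (λ j → copy j (var j) (var (n + j))) n
              (conj-elim product ρ₁ υ₁ _ (⇒-elim body-true head-true)) (toℕ<n i)))

        -- An antecedent has to hold in all components of the product, whereas its consequent may be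
        -- projected to a single one. The hypotheses of copy `i` hold everywhere, so the conclusion
        -- of the chosen clause reaches component `i`.
        goal : Holds product ρ₁ υ₁ (body x) → Goal (κ i) (ρᵢ (toℕ i)) (ρᵢ (n + toℕ i))
        goal body-true = goal-holds (κ i) (toℕ i) {ρᵢ} {λ y → lookup (υ₁ y) i} (var (toℕ i)) (var (n + toℕ i))
          (trans (sym (lookup-evalT i value (λ _ → refl) l))
            (trans (cong (λ d → lookup d i) (≐-elim product ρ₁ υ₁ l r
                     (⇒-elim (clause-true body-true (κ i)) hyps-true)))
              (lookup-evalT i value (λ _ → refl) r)))
          where
          l r : Term
          l = lhs (κ i) (var (toℕ i)) (var (n + toℕ i))
          r = rhs (κ i) (toℕ i) (var (toℕ i)) (var (n + toℕ i))

      some-goal : ⊨ substUnk σ (⋁ n (λ i → substQ (s i) unk (body x))) →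
                  ∃ λ i → Goal (κ i) (ρᵢ i (toℕ i)) (ρᵢ i (n + toℕ i))
      some-goal valid =
        let i , holds = ⋁-elim product ρ₀ ρ₀ σ n (λ i → substQ (s i) unk (body x)) (valid product ρ₀ ρ₀)
        in i , goal i (trans (sym (evalQ-subst product ρ₀ υ₁ (s i) unk (body x)))
             (trans (sym (evalQ-subst product ρ₀ ρ₀ var σ (substQ (s i) unk (body x)))) holds))

    solvable⇒run : ∀ {m} {u : Fin n → Fin m → ℕ} → Solvable (skeleton n m u (body x)) →
                   Run N pre post NoCheck (start x)
    solvable⇒run {m} {u} (σ , _ , valid) =
      let i , goal = some-goal valid in goals⇒run (toℕ i) (L i) (Y i) (proj₂ (choice i) goal)
      where
      s : Fin n → ℕ → Term
      s i = proj₁ (instantiation m (u i) (body x))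
      Goals : Fin n → Kind → Set
      Goals i κ = Goal κ (evI (int κ) (toℕ i) sink sink (substT var σ (s i (toℕ i))))
                         (evI (int κ) (toℕ i) sink sink (substT var σ (s i (n + toℕ i))))
      choice : (i : Fin n) → ∃ λ κ → Goals i κ → ∀ κ′ → Goals i κ′
      choice i = failing (Goals i) (λ κ → Goal? κ _ _)
      open Refutation (λ i → proj₁ (choice i)) σ s

    sk⇒run : Sk n (sentence x) → Run N pre post NoCheck (start x)
    sk⇒run (m , φ , (ψ≡ , _) , u , _ , sol)
      with refl ← trans (sym (matrix-exs (n + n) (body x))) (trans (cong matrix ψ≡) (matrix-exs m φ)) =
      solvable⇒run {m} {u} sol

  noUnkQ-clause : ∀ j i k κ → noUnkQ (clause j (var i) (var k) κ) ≡ true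
  noUnkQ-clause j i k κ = ∧-intro
    (noUnkQ-conj (map⁺ (universal (λ (g , h) → ∧-intro (noUnkT-term j g) (noUnkT-term j h)) (hyps κ)))) (go κ)
    where
    go : ∀ κ → noUnkQ (lhs κ (var i) (var k) ≐ rhs κ j (var i) (var k)) ≡ true
    go shape = refl
    go old = ∧-intro (noUnkT-term j startG) refl
    go new = refl
    go pure = refl

  varsBelowQ-clause : ∀ {m} j {i k} κ → i < m → k < m → varsBelowQ m (clause j (var i) (var k) κ) ≡ true
  varsBelowQ-clause {m} j {i} {k} κ i<m k<m = ∧-intro
    (varsBelowQ-conj m (map⁺ (universal
      (λ (g , h) → ∧-intro (varsBelowT-term m j g) (varsBelowT-term m j h)) (hyps κ)))) (go κ)
    where
    go : ∀ κ → varsBelowQ m (lhs κ (var i) (var k) ≐ rhs κ j (var i) (var k)) ≡ true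
    go shape = ∧-intro (varsBelow-var i<m) refl
    go old = ∧-intro (varsBelow-var i<m) (∧-intro (varsBelowT-term m j startG) (∧-intro (varsBelow-var k<m) refl))
    go new = ∧-intro (varsBelow-var i<m) (varsBelow-var k<m)
    go pure = ∧-intro (varsBelow-var k<m) refl

  noUnkQ-body : ∀ x → noUnkQ (body x) ≡ true
  noUnkQ-body x = ∧-intro
    (noUnkQ-conj (applyUpTo⁺₂ _ n λ j → ∧-intro (noUnkT-term j ι) (noUnkT-term j (numG x))))
    (noUnkQ-conj (applyUpTo⁺₂ _ n λ j → noUnkQ-conj
      (all-kinds (clause j (var j) (var (n + j))) (noUnkQ-clause j j (n + j)))))

  varsBelowQ-body : ∀ x → varsBelowQ (n + n) (body x) ≡ true
  varsBelowQ-body x = ∧-intro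
    (varsBelowQ-conj (n + n) (applyUpTo⁺₂ _ n λ j →
      ∧-intro (varsBelowT-term (n + n) j ι) (varsBelowT-term (n + n) j (numG x))))
    (varsBelowQ-conj (n + n) (applyUpTo⁺₁ _ n λ {j} j<n → varsBelowQ-conj (n + n)
      (all-kinds (clause j (var j) (var (n + j)))
        (λ κ → varsBelowQ-clause j κ (≤-trans j<n (m≤m+n n n)) (+-monoʳ-< n j<n)))))

  module _ (n≥1 : n ≥ 1) (x : ℕ) (run : Run N pre post Ok (start x)) where

    -- Only the first disjunct is made valid. Its unknowns are numbered from 0 to `n + n - 1`, the
    -- first half for the lists of steps and the second half for the lists of configurations; all
    -- further unknowns receive some closed term.
    solution : ℕ → Term
    solution y with y <? n
    ... | yes _ = term y (tilesG run)
    ... | no _ = term (y ∸ n) (confsG run)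

    solution-L : ∀ {j} → j < n → solution j ≡ term j (tilesG run)
    solution-L {j} j<n with j <? n
    ... | yes _ = refl
    ... | no j≮n = ⊥-elim (j≮n j<n)

    solution-Y : ∀ j → solution (n + j) ≡ term j (confsG run)
    solution-Y j with n + j <? n
    ... | yes n+j<n = ⊥-elim (<⇒≱ n+j<n (m≤m+n n j))
    ... | no _ = cong (λ k → term k (confsG run)) (m+n∸m≡n n j)

    solution-closed : SolutionTerms solution
    solution-closed y with y <? n
    ... | yes _ = noUnkT-term y (tilesG run) , noVarT-term y (tilesG run)
    ... | no _ = noUnkT-term (y ∸ n) (confsG run) , noVarT-term (y ∸ n) (confsG run)

    module _ (St : Structure) (ρ υ : ℕ → Structure.D St) where

      copy-valid : ∀ j → evalT St ρ υ (term j ι) ≡ evalT St ρ υ (term j (numG x)) → ∀ L Y →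
        evalT St ρ υ L ≡ evalT St ρ υ (term j (tilesG run)) →
        evalT St ρ υ Y ≡ evalT St ρ υ (term j (confsG run)) → Holds St ρ υ (copy j L Y)
      copy-valid j eq-ι L Y eqL eqY = conj-intro St ρ υ (all-kinds (clause j L Y) valid)
        where
        ev : Tree → Structure.D St
        ev g = evalT St ρ υ (term j g)
        open Completeness ev
          (λ a → cong (λ d → Structure.fn St a 1 (d ∷ [])))
          (cong₂ (λ d e → Structure.fn St 0 2 (d ∷ e ∷ [])))
        goal : ∀ κ → All Valid (hyps κ) → evalT St ρ υ (lhs κ L Y) ≡ evalT St ρ υ (rhs κ j L Y)
        goal shape hs = trans eqL (shape-complete hs run)
        goal old hs = trans eqL (trans (old-complete hs run)
          (cong₂ (λ d e → Structure.fn St 0 2 (d ∷ e ∷ [])) (sym (startG-complete {x} eq-ι)) (sym eqY)))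
        goal new hs = trans eqL (trans (new-complete hs run) (sym eqY))
        goal pure hs = trans eqY (pure-complete hs run)
        valid : ∀ κ → Holds St ρ υ (clause j L Y κ)
        valid κ = ⇒-intro _ λ hs → ≐-intro St ρ υ {lhs κ L Y} {rhs κ j L Y} (goal κ
          (All.map (λ {(g , h)} → ≐-elim St ρ υ (term j g) (term j h)) (map⁻ (conj-elim St ρ υ _ hs))))

      body-valid : (∀ {j} → j < n → ρ j ≡ evalT St ρ υ (term j (tilesG run))) →
                   (∀ {j} → j < n → ρ (n + j) ≡ evalT St ρ υ (term j (confsG run))) →
                   Holds St ρ υ (body x)
      body-valid eqL eqY = ⇒-intro _ λ hd → conj-intro St ρ υ (applyUpTo⁺₁ _ n λ {j} j<n →
        copy-valid j (≐-elim St ρ υ (term j ι) (term j (numG x))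
            (applyUpTo⁻ (λ j → term j ι ≐ term j (numG x)) n (conj-elim St ρ υ _ hd) j<n))
          (var j) (var (n + j)) (eqL j<n) (eqY j<n))

    unknowns : Fin n → Fin (n + n) → ℕ
    unknowns i j = toℕ (combine i j)

    unknowns-distinct : Distinct unknowns
    unknowns-distinct i i′ j j′ eq = combine-injective i j i′ j′ (toℕ-injective eq)

    skeleton-valid : ⊨ substUnk solution (skeleton n (n + n) unknowns (body x))
    skeleton-valid St ρ υ = ⋁-intro St ρ υ solution n (λ i → inst (n + n) (unknowns i) (body x)) i₀
      (trans (evalQ-subst St ρ υ var solution (inst (n + n) (unknowns i₀) (body x)))
        (trans (evalQ-subst St ρ υ₁ s unk (body x))
          (body-valid St ρ₁ υ₁
            (λ {j} j<n → trans (value (≤-trans j<n (m≤m+n n n)))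
              (trans (cong (evalT St ρ υ) (solution-L j<n)) (evalT-term St j (tilesG run))))
            (λ {j} j<n → trans (value (+-monoʳ-< n j<n))
              (trans (cong (evalT St ρ υ) (solution-Y j)) (evalT-term St j (confsG run)))))))
      where
      i₀ : Fin n
      i₀ = fromℕ< n≥1
      s = proj₁ (instantiation (n + n) (unknowns i₀) (body x))
      υ₁ ρ₁ : ℕ → Structure.D St
      υ₁ y = evalT St ρ υ (solution y)
      ρ₁ y = evalT St ρ υ₁ (s y)
      unknown≡ : ∀ j → unknowns i₀ j ≡ toℕ j
      unknown≡ j = trans (toℕ-combine i₀ j)
        (cong (_+ toℕ j) (trans (cong ((n + n) *_) (toℕ-fromℕ< n≥1)) (*-zeroʳ (n + n))))
      value : ∀ {y} → y < n + n → ρ₁ y ≡ evalT St ρ υ (solution y)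
      value {y} y< = trans (cong (evalT St ρ υ₁) (instantiation-unk (n + n) (unknowns i₀) (body x) y<))
        (cong υ₁ (trans (unknown≡ (fromℕ< y<)) (toℕ-fromℕ< y<)))

    run⇒sk : Sk n (sentence x)
    run⇒sk = n + n , body x , (refl , noUnkQ-body x , varsBelowQ-body x) , unknowns , unknowns-distinct ,
      solution , solution-closed , skeleton-valid

-- The diagonal sentence

prefix : ℕ → ℕ → ℕ
prefix zero c = c
prefix (suc m) c = ⟨ 8 , prefix m c ⟩

code-exs : ∀ m ψ → code (exs m ψ) ≡ prefix m (code ψ)
code-exs zero ψ = refl
code-exs (suc m) ψ = cong ⟨ 8 ,_⟩ (code-exs m ψ)

prefix-computable : ∀ m {F} → Computable F → Computable (λ x → prefix m (F x))
prefix-computable zero F = F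
prefix-computable (suc m) F = ⟨⟩-computable (const-computable 8) (prefix-computable m F)

codeT-numG-computable : ∀ j → Computable (λ x → codeT (term j (numG x)))
codeT-numG-computable j = iterate-computable {λ x → codeT (term j (numG x))}
  -- Here `c` codes the previous numeral; 2 is the tag of `fun`, followed by symbol 1, arity 1 and a
  -- list with the single argument `c`.
  {λ c → ⟨ 2 , ⟨ 1 , ⟨ 1 , suc ⟨ c , 0 ⟩ ⟩ ⟩ ⟩} (codeT (term j ε))
  (⟨⟩-computable (const-computable 2) (⟨⟩-computable (const-computable 1) (⟨⟩-computable (const-computable 1)
    (suc-computable (⟨⟩-computable id-computable (const-computable 0))))))
  refl (λ _ → refl)

conj-computable : ∀ n (f : ℕ → ℕ → QF) → (∀ j → Computable (λ x → code (embed (f j x)))) →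
  Computable (λ x → code (embed (conj (applyUpTo (λ j → f j x) n))))
conj-computable zero f F = const-computable (code (embed (conj [])))
conj-computable (suc n) f F = ⟨⟩-computable (const-computable 4)
  (⟨⟩-computable (F 0) (conj-computable n (λ j → f (suc j)) (λ j → F (suc j))))

head-computable : ∀ n → Computable (λ x → code (embed (head n x)))
head-computable n = conj-computable n _ λ j → ⟨⟩-computable (const-computable 1)
  (⟨⟩-computable (const-computable (codeT (term j ι))) (codeT-numG-computable j))

-- The code of the sentence for input x when x is the code of its part not depending on x.
diagonal : ℕ → ℕ → ℕ
diagonal n x = prefix (n + n) ⟨ 6 , ⟨ code (embed (head n x)) , x ⟩ ⟩

diagonal-computable : ∀ n → Computable (diagonal n)
diagonal-computable n = prefix-computable (n + n)
  (⟨⟩-computable (const-computable 6) (⟨⟩-computable (head-computable n) id-computable))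

regW≡ : ∀ x → regW x ≡ 0 ∷ replicate x 1
regW≡ zero = refl
regW≡ (suc x) = trans (cong (_∷ʳ 1) (regW≡ x)) (cong (0 ∷_) (snoc x))
  where
  snoc : ∀ x → replicate x 1 ∷ʳ 1 ≡ 1 ∷ replicate x 1
  snoc zero = refl
  snoc (suc x) = cong (1 ∷_) (snoc x)

module Sentences (n : ℕ) (n≥1 : n ≥ 1) (p : PR 1) where

  -- Register 0 holds the argument and register 1 the claimed value, which `input` sets to 0;
  -- scratch space begins at 2.
  program : Cmd
  program = graph 2 p (0 ∷ []) 1

  input : ℕ → State
  input x zero = x
  input x (suc _) = 0

  open Machine program
  init : ℕ → Word
  init = conf (program ∷ []) (input 0)

  open Encoding components pre post (length rules) alphabet init using (start)
  open Skeletons components pre post (length rules) alphabet init (s≤s z≤n) n public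
    using (rest; sentence; sk⇒run; run⇒sk)

  start≡ : ∀ x i → start x i ≡ conf (program ∷ []) (input x) i
  start≡ x zero = refl
  start≡ x (suc zero) = sym (regW≡ x)
  start≡ x (suc (suc i)) = refl

  sk⇒⇓0 : ∀ x → Sk n (sentence x) → p [ x ∷ [] ]⇓ 0
  sk⇒⇓0 x sk =
    let s′ , c⇓ = machine-sound {s = input x} (Run-resp _ _ _ _ (λ i → sym (start≡ x i)) (sk⇒run x sk))
    in proj₂ (graph-sound 2 p (s≤s z≤n ∷ []) (s≤s (s≤s z≤n)) c⇓)

  ⇓0⇒sk : ∀ x → p [ x ∷ [] ]⇓ 0 → Sk n (sentence x)
  ⇓0⇒sk x p⇓0 =
    let s′ , c⇓ , _ = graph-complete 2 p (s≤s z≤n ∷ []) (s≤s (s≤s z≤n)) {input x} p⇓0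
    in run⇒sk n≥1 x (Run-resp _ _ _ _ (start≡ x) (machine-complete c⇓))

code-sentence : ∀ m a b → code (exs m (embed (a ⇒q b))) ≡ prefix m ⟨ 6 , ⟨ code (embed a) , code (embed b) ⟩ ⟩
code-sentence m a b = code-exs m (embed (a ⇒q b))

-- `Sk n ψ` is not assumed decidable, so its negation comes first: a solvable skeleton would make
-- `e` answer both 1 and 0. The negation forces the answer 0, which yields a solvable skeleton after
-- all. Injectivity of codes is needed because `SkCode` speaks of any formula with the given code.
no-decider : ∀ {n e} {F : ℕ → ℕ} →
  (∀ c → (SkCode n c → e [ c ∷ [] ]⇓ 1) × (¬ SkCode n c → e [ c ∷ [] ]⇓ 0)) →
  (g : Computable F) (ψ : Formula) (x : ℕ) → code ψ ≡ F x →
  (Sk n ψ → C e (proj₁ g ∷ []) [ x ∷ [] ]⇓ 0) →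
  ¬ (C e (proj₁ g ∷ []) [ x ∷ [] ]⇓ 0 → Sk n ψ)
no-decider {n} {e} {F} decides (g , g⇓) ψ x codeψ≡ sound complete = ¬sk (complete (⇓C (g⇓ x ∷ []) e⇓0))
  where
  ¬sk : ¬ Sk n ψ
  ¬sk sk with sound sk
  ... | ⇓C (g⇓y ∷ []) e⇓y with refl ← ⇓-deterministic g⇓y (g⇓ x) =
    0≢1+n (⇓-deterministic e⇓y (proj₁ (decides (F x)) (ψ , codeψ≡ , sk)))
  e⇓0 : e [ F x ∷ [] ]⇓ 0
  e⇓0 = proj₂ (decides (F x)) λ (χ , codeχ≡ , sk) →
    ¬sk (subst (Sk n) (code-injective χ ψ (trans codeχ≡ (sym codeψ≡))) sk)

mainTheorem1 : (n : ℕ) → n ≥ 1 → ¬ Recursive (SkCode n)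
mainTheorem1 n n≥1 (e , decides) =
  no-decider decides (diagonal-computable n) (sentence x) x
    (code-sentence (n + n) (head n x) rest) (sk⇒⇓0 x) (⇓0⇒sk x)
  where
  open Sentences n n≥1 (C e (proj₁ (diagonal-computable n) ∷ []))
  x : ℕ
  -- There is no circularity: `rest` contains the program built from `e` and `diagonal n`, and
  -- `diagonal n` does not mention `rest`. With this input, `diagonal n x` is the code of
  -- `sentence x` itself.
  x = code (embed rest)
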